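{- Let $F$ be a simple graph of order $n\ge 2$, let $E_k=\{e_1,\ldots,e_k\}$ be a subset of the edge set of $F$, and let $H_{uv}$ be a simple graph of order $m\ge 3$ with a specified edge $uv$ such that $H_{uv}-u$ is isomorphic to $H_{uv}-v$ and such that $u$ and $v$ both have degree $m-1$ in $H_{uv}$. Let $H_2=H_{uv}-\{u,v\}$ be an $r_2$-regular graph, where $r_2\ge 2$. Let $q\in\sigma(Q(H_{uv}))\setminus\{m-2,\zeta,\eta\}$, where $\zeta,\eta$ are the roots of the equation $(x-2r_2-2)(x-m)-2(m-2)=0$, and let $G=G[F,E_k,H_{uv}]$. Assume that $\mathscr{E}_k$, the subgraph of $F$ induced by $E_k$, is $r$-regular. If $|E_k|=k$, then $q\in\sigma(Q(G))$ with multiplicity $k$. Moreover, the remaining $n+k$ $Q$-eigenvalues of $G$ are independent of $H_{uv}$.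
   Context: All graphs are finite and simple. For a graph $X$, $Q(X)=D(X)+A(X)$ is the signless Laplacian matrix, where $D(X)$ is the diagonal degree matrix and $A(X)$ the adjacency matrix; the $Q$-eigenvalues of $X$ are the eigenvalues of $Q(X)$, and $\sigma(Q(X))$ is the spectrum of $Q(X)$, consisting of all its eigenvalues. For a graph $X$ of order $s$, $q_1(X)\le\cdots\le q_s(X)$ denote the eigenvalues of $Q(X)$. Under the stated hypotheses, $\sigma(Q(H_{uv}))=\{q_j(H_2)+2 : 1\le j\le m-3\}\cup\{m-2,\zeta,\eta\}$. The subgraph induced by $E_k$ has edge set $E_k$ and, as vertices, the endpoints of the edges in $E_k$. Graph with $k$ edge-pockets: $G[F,E_k,H_{uv}]$ is the graph obtained by taking one copy of $F$ and $k$ vertex-disjoint copies of $H_{uv}$, and then, for each $i=1,\ldots,k$, pasting (identifying) the edge $uv$ in the $i$th copy of $H_{uv}$ with the edge $e_i\in E_k$. -}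

module Defs where

open import Algebra.Bundles using (CommutativeRing; Semiring)
import Algebra.Definitions.RawSemiring as RawSemiringDefs
open import Data.Bool.Base using (Bool; true; false; _∧_; _∨_; if_then_else_)
open import Data.Bool.Properties using (∧-zeroʳ)
open import Data.Fin.Base using (Fin; zero; suc; toℕ; punchIn; punchOut; splitAt; remQuot)
open import Data.Fin.Properties using (_≟_; any?)
open import Data.Fin.Subset using (∣_∣)
open import Data.List.Base using (List; foldr; length)
import Data.List.Relation.Binary.Permutation.Setoid as SetoidPermutation
open import Data.Nat.Base as ℕ using (ℕ)
open import Data.Product.Base using (Σ; ∃-syntax; _×_; _,_; map₂)
open import Data.Sum.Base as Sum using (_⊎_; inj₁; inj₂)
import Data.Vec.Base as Vec
open import Data.Vec.Functional using (Vector)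
open import Function.Base using (_∘_; id)
open import Function.Bundles using (_↔_; module Inverse; mk⇔)
open import Level using (_⊔_) renaming (suc to lsuc)
open import Relation.Binary.Core using (Rel)
open import Relation.Binary.PropositionalEquality
  using (_≡_; _≢_; refl; sym; trans; cong; cong₂)
open import Relation.Binary.Structures using (IsDecTotalOrder)
open import Relation.Nullary using (¬_; Dec; does; _×-dec_; _⊎-dec_)
open import Relation.Nullary.Decidable using (does-⇔; dec-false)

------------------------------------------------------------------------
-- Graphs

record Graph (V : Set) : Set where
  field
    adj        : V → V → Bool
    adj-sym    : ∀ x y → adj x y ≡ adj y x
    adj-irrefl : ∀ x → adj x x ≡ false

open Graph public

-- For injective f this is the subgraph induced on the image of f.
pullback : ∀ {V W : Set} → (W → V) → Graph V → Graph W
pullback f X = record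
  { adj        = λ x y → adj X (f x) (f y)
  ; adj-sym    = λ x y → adj-sym X (f x) (f y)
  ; adj-irrefl = λ x → adj-irrefl X (f x)
  }

infixl 6 _∖_
_∖_ : ∀ {s} → Graph (Fin (ℕ.suc s)) → Fin (ℕ.suc s) → Graph (Fin s)
X ∖ v = pullback (punchIn v) X

infix 4 _≅_
_≅_ : ∀ {V W : Set} → Graph V → Graph W → Set
_≅_ {V} {W} X Y = Σ (V ↔ W) λ f →
  ∀ x y → adj X x y ≡ adj Y (Inverse.to f x) (Inverse.to f y)

deg : ∀ {s} → Graph (Fin s) → Fin s → ℕ
deg X v = ∣ Vec.tabulate (adj X v) ∣

Regular : ∀ {s} → Graph (Fin s) → ℕ → Set
Regular X r = ∀ v → deg X v ≡ r

adj⇒≢ : ∀ {V : Set} (X : Graph V) {x y} → adj X x y ≡ true → x ≢ y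
adj⇒≢ X {x} e refl with trans (sym (adj-irrefl X x)) e
... | ()

------------------------------------------------------------------------
-- Sets of k edges

-- A set E_k of exactly k edges of F, enumerated as e_i = {a i , b i}.  The
-- order of the two endpoints only fixes which of them u is pasted onto.
record EdgeSet {n : ℕ} (F : Graph (Fin n)) (k : ℕ) : Set where
  field
    a b      : Fin k → Fin n
    isEdge   : ∀ i → adj F (a i) (b i) ≡ true
    distinct : ∀ i j → (a i ≡ a j × b i ≡ b j) ⊎ (a i ≡ b j × b i ≡ a j) → i ≡ j

  Joins : Fin k → Fin n → Fin n → Set
  Joins i x y = (x ≡ a i × y ≡ b i) ⊎ (x ≡ b i × y ≡ a i)

  joins? : ∀ i x y → Dec (Joins i x y)
  joins? i x y = (x ≟ a i ×-dec y ≟ b i) ⊎-dec (x ≟ b i ×-dec y ≟ a i)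

  Endpoint : Fin n → Set
  Endpoint x = ∃[ i ] (x ≡ a i ⊎ x ≡ b i)

  joins-sym : ∀ {i x y} → Joins i x y → Joins i y x
  joins-sym (inj₁ (p , q)) = inj₂ (q , p)
  joins-sym (inj₂ (p , q)) = inj₁ (q , p)

  joins-irrefl : ∀ {x} → ¬ (∃[ i ] Joins i x x)
  joins-irrefl (i , inj₁ (p , q)) = adj⇒≢ F (isEdge i) (trans (sym p) q)
  joins-irrefl (i , inj₂ (p , q)) = adj⇒≢ F (isEdge i) (trans (sym q) p)

  -- The graph (V(F), E_k).  It has the same degrees at the endpoints of E_k
  -- as the subgraph induced by E_k, whose vertices are only those endpoints.
  spanning : Graph (Fin n)
  spanning = record
    { adj        = λ x y → does (any? λ i → joins? i x y)
    ; adj-sym    = λ x y → does-⇔ (mk⇔ (map₂ joins-sym) (map₂ joins-sym))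
                                  (any? λ i → joins? i x y) (any? λ i → joins? i y x)
    ; adj-irrefl = λ x → dec-false (any? λ i → joins? i x x) joins-irrefl
    }

  InducedRegular : ℕ → Set
  InducedRegular r = ∀ x → Endpoint x → deg spanning x ≡ r

------------------------------------------------------------------------
-- Edge-pockets

-- A graph H_uv of order m = 2 + p with a specified edge uv.
record EdgeGraph (p : ℕ) : Set where
  field
    H    : Graph (Fin (2 ℕ.+ p))
    u v  : Fin (2 ℕ.+ p)
    edge : adj H u v ≡ true

  -- v as a vertex of H ∖ u
  v′ : Fin (1 ℕ.+ p)
  v′ = punchOut (adj⇒≢ H edge)

  H₂ : Graph (Fin p)
  H₂ = H ∖ u ∖ v′

  -- the inclusion of the vertices of H₂ into those of H
  ι : Fin p → Fin (2 ℕ.+ p)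
  ι = punchIn u ∘ punchIn v′

record Admissible {p : ℕ} (Huv : EdgeGraph p) (r₂ : ℕ) : Set where
  open EdgeGraph Huv
  field
    iso     : H ∖ u ≅ H ∖ v
    deg-u   : deg H u ≡ (2 ℕ.+ p) ℕ.∸ 1
    deg-v   : deg H v ≡ (2 ℕ.+ p) ℕ.∸ 1
    regular : Regular H₂ r₂

-- G[F,E_k,H_uv].  The vertex inj₁ x is the vertex x of F, and inj₂ (i , w) is
-- the vertex ι w of the i-th copy of H_uv; in that copy u is identified with
-- a i and v with b i.  Two vertices of F need no clause of their own for the
-- copies, since the only edge they contribute there is the pasted one, e_i.
module Pocket {n k p : ℕ} (F : Graph (Fin n)) (E : EdgeSet F k) (Huv : EdgeGraph p) where
  open EdgeSet E
  open EdgeGraph Huv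

  Vertex : Set
  Vertex = Fin n ⊎ (Fin k × Fin p)

  attached : Fin n → Fin k → Fin p → Bool
  attached x i w = (does (x ≟ a i) ∧ adj H u (ι w)) ∨ (does (x ≟ b i) ∧ adj H v (ι w))

  adjG : Vertex → Vertex → Bool
  adjG (inj₁ x)       (inj₁ y)       = adj F x y
  adjG (inj₁ x)       (inj₂ (i , w)) = attached x i w
  adjG (inj₂ (i , w)) (inj₁ x)       = attached x i w
  adjG (inj₂ (i , w)) (inj₂ (j , z)) = does (i ≟ j) ∧ adj H (ι w) (ι z)

  adjG-sym : ∀ x y → adjG x y ≡ adjG y x
  adjG-sym (inj₁ x)       (inj₁ y)       = adj-sym F x y
  adjG-sym (inj₁ x)       (inj₂ (i , w)) = refl
  adjG-sym (inj₂ (i , w)) (inj₁ x)       = refl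
  adjG-sym (inj₂ (i , w)) (inj₂ (j , z)) =
    cong₂ _∧_ (does-⇔ (mk⇔ sym sym) (i ≟ j) (j ≟ i)) (adj-sym H (ι w) (ι z))

  adjG-irrefl : ∀ x → adjG x x ≡ false
  adjG-irrefl (inj₁ x)       = adj-irrefl F x
  adjG-irrefl (inj₂ (i , w)) =
    trans (cong (does (i ≟ i) ∧_) (adj-irrefl H (ι w))) (∧-zeroʳ (does (i ≟ i)))

  pocketGraph : Graph Vertex
  pocketGraph = record { adj = adjG ; adj-sym = adjG-sym ; adj-irrefl = adjG-irrefl }

  enumerate : Fin (n ℕ.+ k ℕ.* p) → Vertex
  enumerate = Sum.map id (remQuot p) ∘ splitAt n

G[_,_,_] : ∀ {n k p} (F : Graph (Fin n)) → EdgeSet F k → EdgeGraph p →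
           Graph (Fin (n ℕ.+ k ℕ.* p))
G[ F , E , Huv ] = pullback enumerate pocketGraph
  where open Pocket F E Huv

------------------------------------------------------------------------
-- The field of scalars

-- Discrete real closed fields stand in for the real numbers.
record RealClosedField c ℓ₁ ℓ₂ : Set (lsuc (c ⊔ ℓ₁ ⊔ ℓ₂)) where
  infix 4 _≤_
  field
    commutativeRing : CommutativeRing c ℓ₁
  open CommutativeRing commutativeRing public
  open RawSemiringDefs (Semiring.rawSemiring (CommutativeRing.semiring commutativeRing)) public
    using (sum; _^_) renaming (_×_ to _·_)
  field
    _≤_             : Rel Carrier ℓ₂
    isDecTotalOrder : IsDecTotalOrder _≈_ _≤_
    +-monoˡ-≤       : ∀ z {x y} → x ≤ y → x + z ≤ y + z
    *-nonNeg        : ∀ {x y} → 0# ≤ x → 0# ≤ y → 0# ≤ x * y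
    0≉1             : ¬ (0# ≈ 1#)
    inverse         : ∀ x → ¬ (x ≈ 0#) → ∃[ y ] x * y ≈ 1#
    squareRoot      : ∀ x → 0# ≤ x → ∃[ y ] y * y ≈ x
    oddRoot         : ∀ d (a : Vector Carrier (1 ℕ.+ 2 ℕ.* d)) →
                      ∃[ x ] x ^ (1 ℕ.+ 2 ℕ.* d) + sum (λ i → a i * x ^ toℕ i) ≈ 0#

module Spectra {c ℓ₁ ℓ₂} (ℝ : RealClosedField c ℓ₁ ℓ₂) where
  open RealClosedField ℝ using
    (Carrier; _≈_; _+_; _-_; _*_; -_; 0#; 1#; _·_; _^_; sum; commutativeRing)
  open SetoidPermutation (CommutativeRing.setoid commutativeRing) public using (_↭_)

  fromℕ : ℕ → Carrier
  fromℕ n = n · 1#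

  Matrix : ℕ → Set c
  Matrix s = Fin s → Fin s → Carrier

  diagonal : ∀ {s} → (Fin s → Carrier) → Matrix s
  diagonal d i j = if does (i ≟ j) then d i else 0#

  -- Laplace expansion along the first row
  det : ∀ {s} → Matrix s → Carrier
  det {ℕ.zero}  M = 1#
  det {ℕ.suc s} M =
    sum λ j → (- 1#) ^ toℕ j * M zero j * det (λ i l → M (suc i) (punchIn j l))

  degreeMatrix adjacencyMatrix Q : ∀ {s} → Graph (Fin s) → Matrix s
  degreeMatrix X = diagonal (fromℕ ∘ deg X)
  adjacencyMatrix X i j = if adj X i j then 1# else 0#
  Q X i j = degreeMatrix X i j + adjacencyMatrix X i j

  -- det (xI − M) as a function of x; as the field is infinite, this function
  -- determines the characteristic polynomial.
  charPoly : ∀ {s} → Matrix s → Carrier → Carrier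
  charPoly M x = det λ i j → diagonal (λ _ → x) i j - M i j

  -- The list L consists of all eigenvalues of M, repeated according to their
  -- multiplicity as roots of the characteristic polynomial, in any order.
  IsSpectrum : ∀ {s} → Matrix s → List Carrier → Set (c ⊔ ℓ₁)
  IsSpectrum {s} M L =
    length L ≡ s × (∀ x → charPoly M x ≈ foldr (λ q y → (x - q) * y) 1# L)

  -- "ζ and η are the roots of (x − 2r₂ − 2)(x − m) − 2(m − 2) = 0"
  AreRoots : (m r₂ : ℕ) (ζ η : Carrier) → Set (c ⊔ ℓ₁)
  AreRoots m r₂ ζ η = ∀ x →
    (equation x → x ≈ ζ ⊎ x ≈ η) × (x ≈ ζ ⊎ x ≈ η → equation x)
    where
    equation : Carrier → Set ℓ₁
    equation x =
      (x - fromℕ (2 ℕ.* r₂) - fromℕ 2) * (x - fromℕ m) - fromℕ (2 ℕ.* (m ℕ.∸ 2)) ≈ 0#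

{-# OPTIONS --safe #-}

-- The block of G that belongs to one pocket is M = xI − (Q(H₂) + 2I), whose column
-- sums all equal γ = x − 2r₂ − 2 because H₂ is regular.  Hence a border with constant
-- rows can be cleared by subtracting 1/γ times sums of the rows of the pockets.
-- For H_uv this gives γ det(xI − Q(H)) = (x − (m − 2)) ((x − m) γ − 2(m − 2)) det M, so
-- that det M = γ ∏ (x − q) outside finitely many x.  For G it gives det(M)^k times
-- the determinant of a Schur complement that knows H_uv only through p and r₂, and
-- the k factors γ are absorbed into that determinant by shrinking each pocket to a
-- single weighted vertex.  What remains is polynomial in x, so the k-fold roots q can
-- be divided out of the characteristic polynomial of G.

module Submission where

open import Defs
import Algebra.Properties.CommutativeSemiring.Exp as CommutativeSemiringExp
import Algebra.Properties.Ring as RingProperties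
import Algebra.Properties.Semiring.Exp as SemiringExp
import Algebra.Properties.Semiring.Mult as SemiringMult
import Algebra.Properties.Semiring.Sum as SemiringSum
import Algebra.Solver.Ring as RingSolver
open import Algebra.Bundles using (CommutativeRing; RawRing)
open import Algebra.Solver.Ring.AlmostCommutativeRing using (_-Raw-AlmostCommutative⟶_; fromCommutativeRing)
open import Data.Bool.Base using (Bool; true; false; _∧_; _∨_; if_then_else_)
open import Data.Empty using (⊥; ⊥-elim)
open import Data.Fin.Base using (Fin; zero; suc; toℕ; punchIn; lift; _↑ˡ_; _↑ʳ_; splitAt; remQuot; join; combine)
open import Data.Fin.Properties using (_≟_; toℕ-↑ˡ; splitAt-↑ˡ; splitAt-↑ʳ; punchIn-injective; punchInᵢ≢i; punchIn-punchOut; lift-injective; join-splitAt; combine-remQuot)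
open import Data.Fin.Subset using (∣_∣)
open import Data.Fin.Subset.Properties using (∣p∣≡n⇒p≡⊤)
open import Data.Integer.Base as ℤ using (ℤ; +_; -[1+_]; _⊖_)
import Data.Integer.Properties as ℤ
open import Data.List.Base using (List; []; _∷_; _++_; map; length; foldr; concatMap; replicate)
open import Data.List.Properties using (length-++; length-replicate; ++-identityʳ)
import Data.List.Relation.Binary.Permutation.Setoid as SetoidPermutation
import Data.List.Relation.Binary.Permutation.Setoid.Properties as SetoidPermutationProperties
open import Data.List.Relation.Binary.Pointwise using (Pointwise; []; _∷_)
open import Data.List.Relation.Unary.All as All using (All; []; _∷_)
open import Data.Maybe.Base using (Maybe; just; nothing)
open import Data.Nat.Base as ℕ using (ℕ; zero; suc)
import Data.Nat.Properties as ℕ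
open import Data.Nat.Solver using (module +-*-Solver)
open import Data.Product.Base as Product using (_×_; _,_; proj₁; proj₂; ∃-syntax; uncurry)
open import Data.Sum.Base as Sum using (_⊎_; inj₁; inj₂; [_,_]′)
import Data.Vec.Base as Vec
open import Data.Vec.Properties using (lookup∘tabulate; lookup-replicate)
open import Function.Base using (_∘_; id)
open import Function.Bundles using (mk⇔)
open import Function.Definitions using (Injective)
open import Level using (Level)
open import Relation.Binary.PropositionalEquality as ≡ using (_≡_; _≢_)
open import Relation.Binary.Structures using (IsDecTotalOrder)
open import Relation.Nullary using (¬_; Dec; does; yes; no)
open import Relation.Nullary.Decidable using (does-⇔; dec-true; dec-false)

-- A value in `qs` may be repeated, or may equal m - 2, ζ, η or the zero 2r₂ + 2 of γ. At those
-- points the determinant argument divides by zero, so multiplicities cannot be read off pointwise.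
-- The identities are proved away from a finite list of points and then extended because both sides
-- are polynomial; the order of the field supplies points outside any finite list. The list `T`
-- comes from unique factorisation of products of linear factors, and no eigenvectors are
-- constructed. A pocket can shrink to one vertex because the Schur complement sees it only through
-- the scalar p/γ: p equal border rows, and common column sum γ. One vertex with diagonal entry γ
-- and weight p gives the same scalar, and its own block has determinant γ. The resulting matrix has
-- order n + k, which is the number of remaining eigenvalues.

module EdgePockets {c ℓ₁ ℓ₂ : Level} (ℝ : RealClosedField c ℓ₁ ℓ₂) where
  open RealClosedField ℝ hiding (zero)
  open Spectra ℝ
  open RingProperties ring using (-0#≈0#; -‿distribˡ-*; -‿distribʳ-*; -‿involutive; -1*x≈-x; -‿+-comm)
  module ΣR = SemiringSum semiring
  open SemiringMult semiring using (×-homo-+; ×-congʳ; ×-assoc-*)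
  open SemiringExp semiring using (^-congˡ)
  open CommutativeSemiringExp commutativeSemiring using (^-distrib-*)
  open import Relation.Binary.Reasoning.Setoid setoid

  -- Scalars: the ring solver with integer coefficients.

  -- Integer coefficients, because equality of scalars does not compute and the
  -- ring solver could not cancel constants.
  ℤ-rawRing : RawRing _ _
  ℤ-rawRing = CommutativeRing.rawRing ℤ.+-*-commutativeRing

  fromℤ : ℤ → Carrier
  fromℤ (+ n)    = fromℕ n
  fromℤ -[1+ n ] = - fromℕ (suc n)

  fromℤ-⊖ : ∀ m n → fromℤ (m ⊖ n) ≈ fromℕ m - fromℕ n
  fromℤ-⊖ m zero = sym (trans (+-congˡ -0#≈0#) (+-identityʳ _))
  fromℤ-⊖ zero (suc n) = sym (+-identityˡ _)
  fromℤ-⊖ (suc m) (suc n) = begin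
    fromℤ (suc m ⊖ suc n)                     ≡⟨ ≡.cong fromℤ (ℤ.[1+m]⊖[1+n]≡m⊖n m n) ⟩
    fromℤ (m ⊖ n)                             ≈⟨ fromℤ-⊖ m n ⟩
    fromℕ m - fromℕ n                         ≈⟨ +-identityˡ _ ⟨
    0# + (fromℕ m - fromℕ n)                  ≈⟨ +-congʳ (-‿inverseʳ 1#) ⟨
    (1# - 1#) + (fromℕ m - fromℕ n)           ≈⟨ +-assoc _ _ _ ⟩
    1# + (- 1# + (fromℕ m - fromℕ n))         ≈⟨ +-congˡ (+-assoc _ _ _) ⟨
    1# + ((- 1# + fromℕ m) - fromℕ n)         ≈⟨ +-congˡ (+-congʳ (+-comm _ _)) ⟩
    1# + ((fromℕ m - 1#) - fromℕ n)           ≈⟨ +-congˡ (+-assoc _ _ _) ⟩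
    1# + (fromℕ m + (- 1# - fromℕ n))         ≈⟨ +-assoc _ _ _ ⟨
    (1# + fromℕ m) + (- 1# - fromℕ n)         ≈⟨ +-congˡ (-‿+-comm _ _) ⟩
    (1# + fromℕ m) - (1# + fromℕ n)           ∎

  fromℤ-+ : ∀ i j → fromℤ (i ℤ.+ j) ≈ fromℤ i + fromℤ j
  fromℤ-+ (+ m)    (+ n)    = ×-homo-+ 1# m n
  fromℤ-+ (+ m)    -[1+ n ] = fromℤ-⊖ m (suc n)
  fromℤ-+ -[1+ m ] (+ n)    = trans (fromℤ-⊖ n (suc m)) (+-comm _ _)
  fromℤ-+ -[1+ m ] -[1+ n ] = begin
    - fromℕ (suc (suc (m ℕ.+ n)))            ≡⟨ ≡.cong (λ k → - fromℕ k) (≡.sym (≡.cong suc (ℕ.+-suc m n))) ⟩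
    - fromℕ (suc m ℕ.+ suc n)                ≈⟨ -‿cong (×-homo-+ 1# (suc m) (suc n)) ⟩
    - (fromℕ (suc m) + fromℕ (suc n))        ≈⟨ -‿+-comm _ _ ⟨
    - fromℕ (suc m) - fromℕ (suc n)          ∎

  fromℤ-neg : ∀ i → fromℤ (ℤ.- i) ≈ - fromℤ i
  fromℤ-neg (+ zero)  = sym -0#≈0#
  fromℤ-neg (+ suc n) = refl
  fromℤ-neg -[1+ n ]  = sym (-‿involutive _)

  fromℤ-+* : ∀ m j → fromℤ ((+ m) ℤ.* j) ≈ fromℕ m * fromℤ j
  fromℤ-+* zero j = trans (reflexive (≡.cong fromℤ (ℤ.*-zeroˡ j))) (sym (zeroˡ _))
  fromℤ-+* (suc m) j = begin
    fromℤ ((+ suc m) ℤ.* j)           ≡⟨ ≡.cong fromℤ (ℤ.suc-* (+ m) j) ⟩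
    fromℤ (j ℤ.+ (+ m) ℤ.* j)         ≈⟨ fromℤ-+ j _ ⟩
    fromℤ j + fromℤ ((+ m) ℤ.* j)     ≈⟨ +-cong (sym (*-identityˡ _)) (fromℤ-+* m j) ⟩
    1# * fromℤ j + fromℕ m * fromℤ j  ≈⟨ distribʳ _ _ _ ⟨
    (1# + fromℕ m) * fromℤ j          ∎

  fromℤ-* : ∀ i j → fromℤ (i ℤ.* j) ≈ fromℤ i * fromℤ j
  fromℤ-* (+ m)    j = fromℤ-+* m j
  fromℤ-* -[1+ m ] j = begin
    fromℤ (-[1+ m ] ℤ.* j)            ≡⟨ ≡.cong fromℤ (ℤ.neg-distribˡ-* (+ suc m) j) ⟨
    fromℤ (ℤ.- ((+ suc m) ℤ.* j))     ≈⟨ fromℤ-neg ((+ suc m) ℤ.* j) ⟩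
    - fromℤ ((+ suc m) ℤ.* j)         ≈⟨ -‿cong (fromℤ-+* (suc m) j) ⟩
    - (fromℕ (suc m) * fromℤ j)       ≈⟨ -‿distribˡ-* _ _ ⟩
    fromℤ -[1+ m ] * fromℤ j          ∎

  fromℤ-morphism : ℤ-rawRing -Raw-AlmostCommutative⟶ fromCommutativeRing commutativeRing
  fromℤ-morphism = record
    { ⟦_⟧ = fromℤ ; +-homo = fromℤ-+ ; *-homo = fromℤ-* ; -‿homo = fromℤ-neg
    ; 0-homo = refl ; 1-homo = +-identityʳ 1# }

  fromℤ-≟ : ∀ i j → Maybe (fromℤ i ≈ fromℤ j)
  fromℤ-≟ i j with i ℤ.≟ j
  ... | yes ≡.refl = just refl
  ... | no  _      = nothing

  module Solver = RingSolver ℤ-rawRing (fromCommutativeRing commutativeRing) fromℤ-morphism fromℤ-≟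
  open Solver using (solve; _:=_; _:+_; _:*_; _:-_; :-_; con)

  -- Scalars: consequences of the order and of inverses.

  module Order = IsDecTotalOrder isDecTotalOrder

  0≤1 : 0# ≤ 1#
  0≤1 with Order.total 0# 1#
  ... | inj₁ p = p
  ... | inj₂ q = Order.≤-respʳ-≈ (trans (sym (-‿distribʳ-* _ _)) (trans (-‿cong (*-identityʳ _)) (-‿involutive 1#))) (*-nonNeg 0≤-1 0≤-1)
    where
    0≤-1 : 0# ≤ - 1#
    0≤-1 = Order.≤-respʳ-≈ (+-identityˡ _) (Order.≤-respˡ-≈ (-‿inverseʳ 1#) (+-monoˡ-≤ (- 1#) q))

  -- Cancelling x would leave 1 ≤ 0, hence 0 ≈ 1. Both facts that the order contributes rest on
  -- this: 2 is invertible, and the field is infinite (`fresh`).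
  ¬x+1≤x : ∀ x → ¬ (x + 1# ≤ x)
  ¬x+1≤x x le = 0≉1 (Order.antisym 0≤1 (Order.≤-respʳ-≈ (-‿inverseʳ x)
    (Order.≤-respˡ-≈ (solve 2 (λ x y → x :+ y :- x := y) refl x 1#) (+-monoˡ-≤ (- x) le))))

  2≉0 : ¬ (1# + 1# ≈ 0#)
  2≉0 e = ¬x+1≤x 1# (Order.trans (Order.≤-respˡ-≈ (sym e) Order.refl) 0≤1)

  *-cancelˡ : ∀ {x y z} → ¬ (x ≈ 0#) → x * y ≈ x * z → y ≈ z
  *-cancelˡ {x} {y} {z} x≉0 e with inverse x x≉0
  ... | x⁻¹ , xx⁻¹≈1 = begin
    y              ≈⟨ lemma y ⟨
    x⁻¹ * (x * y)  ≈⟨ *-congˡ e ⟩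
    x⁻¹ * (x * z)  ≈⟨ lemma z ⟩
    z              ∎
    where
    lemma : ∀ w → x⁻¹ * (x * w) ≈ w
    lemma w = begin
      x⁻¹ * (x * w)  ≈⟨ solve 3 (λ x x⁻¹ w → x⁻¹ :* (x :* w) := (x :* x⁻¹) :* w) refl x x⁻¹ w ⟩
      (x * x⁻¹) * w  ≈⟨ *-congʳ xx⁻¹≈1 ⟩
      1# * w         ≈⟨ *-identityˡ w ⟩
      w              ∎

  x*y≈0⇒y≈0 : ∀ {x y} → ¬ (x ≈ 0#) → x * y ≈ 0# → y ≈ 0#
  x*y≈0⇒y≈0 x≉0 e = *-cancelˡ x≉0 (trans e (sym (zeroʳ _)))

  x≈-x⇒x≈0 : ∀ {x} → x ≈ - x → x ≈ 0#
  x≈-x⇒x≈0 {x} e = x*y≈0⇒y≈0 2≉0 (begin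
    (1# + 1#) * x    ≈⟨ distribʳ x 1# 1# ⟩
    1# * x + 1# * x  ≈⟨ +-cong (*-identityˡ x) (trans (*-identityˡ x) e) ⟩
    x - x            ≈⟨ -‿inverseʳ x ⟩
    0#               ∎)

  x-y≈0⇒x≈y : ∀ {x y} → x - y ≈ 0# → x ≈ y
  x-y≈0⇒x≈y {x} {y} e = trans (solve 2 (λ x y → x := (x :- y) :+ y) refl x y) (trans (+-congʳ e) (+-identityˡ y))

  -- Finite sums.

  -- ∑ and Det are sealed: unfolded, sum and det would not let unification recover
  -- their arguments.
  opaque
    ∑ : ∀ {s} → (Fin s → Carrier) → Carrier
    ∑ = sum

    ∑-suc : ∀ {s} (f : Fin (suc s) → Carrier) → ∑ f ≈ f zero + ∑ (f ∘ suc)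
    ∑-suc f = refl

    ∑-cong : ∀ {s} {f g : Fin s → Carrier} → (∀ i → f i ≈ g i) → ∑ f ≈ ∑ g
    ∑-cong = ΣR.sum-cong-≋

    ∑-const : ∀ s x → ∑ {s} (λ _ → x) ≈ fromℕ s * x
    ∑-const s x = trans (ΣR.sum-replicate s) (trans (×-congʳ s (sym (*-identityˡ x))) (sym (×-assoc-* s 1# x)))

    ∑-zero : ∀ {s} {f : Fin s → Carrier} → (∀ i → f i ≈ 0#) → ∑ f ≈ 0#
    ∑-zero {s} e = trans (∑-cong e) (ΣR.sum-replicate-zero s)

    *-distribˡ-∑ : ∀ {s} x (f : Fin s → Carrier) → x * ∑ f ≈ ∑ (λ i → x * f i)
    *-distribˡ-∑ = ΣR.*-distribˡ-sum

    *-distribʳ-∑ : ∀ {s} x (f : Fin s → Carrier) → ∑ f * x ≈ ∑ (λ i → f i * x)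
    *-distribʳ-∑ = ΣR.*-distribʳ-sum

    ∑-+ : ∀ {s} (f g : Fin s → Carrier) → ∑ (λ i → f i + g i) ≈ ∑ f + ∑ g
    ∑-+ = ΣR.∑-distrib-+

    ∑-comm : ∀ {s t} (f : Fin s → Fin t → Carrier) → ∑ (λ i → ∑ (f i)) ≈ ∑ (λ j → ∑ (λ i → f i j))
    ∑-comm = ΣR.∑-comm

    ∑-remove : ∀ {s} (w : Fin (suc s)) (f : Fin (suc s) → Carrier) → ∑ f ≈ f w + ∑ (f ∘ punchIn w)
    ∑-remove w f = ΣR.sum-remove {i = w} f

    ∑-↑ : ∀ m {n} (f : Fin (m ℕ.+ n) → Carrier) → ∑ f ≈ ∑ (λ i → f (i ↑ˡ n)) + ∑ (λ i → f (m ↑ʳ i))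
    ∑-↑ zero    f = sym (+-identityˡ _)
    ∑-↑ (suc m) f = trans (+-congˡ (∑-↑ m (f ∘ suc))) (sym (+-assoc _ _ _))

  ∑-neg : ∀ {s} (f : Fin s → Carrier) → ∑ (λ i → - f i) ≈ - ∑ f
  ∑-neg f = begin
    ∑ (λ i → - f i)       ≈⟨ ∑-cong (λ i → -1*x≈-x (f i)) ⟨
    ∑ (λ i → - 1# * f i)  ≈⟨ *-distribˡ-∑ (- 1#) f ⟨
    - 1# * ∑ f            ≈⟨ -1*x≈-x _ ⟩
    - ∑ f                 ∎

  remQuot-↑ˡ : ∀ {k p} (w : Fin p) → remQuot {suc k} p (w ↑ˡ (k ℕ.* p)) ≡ (zero , w)
  remQuot-↑ˡ {k} {p} w rewrite splitAt-↑ˡ p w (k ℕ.* p) = ≡.refl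

  remQuot-↑ʳ : ∀ {k p} (a : Fin (k ℕ.* p)) → remQuot {suc k} p (p ↑ʳ a) ≡ Product.map₁ suc (remQuot {k} p a)
  remQuot-↑ʳ {k} {p} a rewrite splitAt-↑ʳ p (k ℕ.* p) a = ≡.refl

  ∑-remQuot : ∀ k p (f : Fin k × Fin p → Carrier) →
                ∑ (λ a → f (remQuot {k} p a)) ≈ ∑ λ i → ∑ λ w → f (i , w)
  ∑-remQuot zero p f = trans (∑-zero λ ()) (sym (∑-zero λ ()))
  ∑-remQuot (suc k) p f = begin
    ∑ (λ a → f (remQuot {suc k} p a))
      ≈⟨ ∑-↑ p (λ a → f (remQuot {suc k} p a)) ⟩
    ∑ (λ w → f (remQuot {suc k} p (w ↑ˡ (k ℕ.* p)))) + ∑ (λ a → f (remQuot {suc k} p (p ↑ʳ a)))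
      ≈⟨ +-cong (∑-cong λ w → reflexive (≡.cong f (remQuot-↑ˡ {k} w)))
                (trans (∑-cong λ a → reflexive (≡.cong f (remQuot-↑ʳ {k} a)))
                       (∑-remQuot k p (f ∘ Product.map₁ suc))) ⟩
    ∑ (λ w → f (zero , w)) + ∑ (λ i → ∑ λ w → f (suc i , w))
      ≈⟨ ∑-suc _ ⟨
    ∑ (λ i → ∑ λ w → f (i , w)) ∎

  -- Determinants

  sgn : ∀ {s} → Fin s → Carrier
  sgn j = (- 1#) ^ toℕ j

  minor : ∀ {s} → Matrix (suc s) → Fin (suc s) → Fin (suc s) → Matrix s
  minor M i j a b = M (punchIn i a) (punchIn j b)

  infix 9 _ᵀ
  _ᵀ : ∀ {s} → Matrix s → Matrix s
  (M ᵀ) i j = M j i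

  opaque
    unfolding ∑

    Det : ∀ {s} → Matrix s → Carrier
    Det = det

    Det≈det : ∀ {s} (M : Matrix s) → Det M ≈ det M
    Det≈det M = refl

    det-zero : (M : Matrix zero) → Det M ≈ 1#
    det-zero M = refl

    det-row : ∀ {s} (M : Matrix (suc s)) → Det M ≈ ∑ λ j → sgn j * M zero j * Det (minor M zero j)
    det-row M = refl

  det-cong : ∀ {s} {M N : Matrix s} → (∀ i j → M i j ≈ N i j) → Det M ≈ Det N
  det-cong {zero}  e = trans (det-zero _) (sym (det-zero _))
  det-cong {suc s} e = trans (det-row _) (trans
    (∑-cong λ j → *-cong (*-congˡ (e zero j)) (det-cong λ a b → e (suc a) (punchIn j b)))
    (sym (det-row _)))

  -- Expanding along the first row and then the first column is symmetric in rows
  -- and columns, which gives the invariance under transposition.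
  det-expand : ∀ {s} → (∀ (N : Matrix (suc s)) → Det N ≈ Det (N ᵀ)) → (M : Matrix (suc (suc s))) →
    Det M ≈ 1# * M zero zero * Det (minor M zero zero) +
      ∑ λ j → ∑ λ i → sgn (suc j) * M zero (suc j) * (sgn i * M (suc i) zero * Det (minor (minor M zero zero) i j ᵀ))
  det-expand ih M = trans (det-row M) (trans (∑-suc _) (+-congˡ (∑-cong λ j →
    trans (*-congˡ (trans (ih (minor M zero (suc j))) (det-row _))) (*-distribˡ-∑ _ _))))

  det-ᵀ : ∀ s (M : Matrix s) → Det M ≈ Det (M ᵀ)
  det-ᵀ zero       M = trans (det-zero M) (sym (det-zero _))
  -- The double expansion needs order at least 2 and uses the induction hypothesis at both smaller
  -- orders, whence two base cases.
  det-ᵀ (suc zero) M = det-cong λ { zero zero → refl }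
  det-ᵀ (suc (suc s)) M = begin
    Det M
      ≈⟨ det-expand (det-ᵀ (suc s)) M ⟩
    corner + ∑ (λ j → ∑ λ i → term M i j)
      ≈⟨ +-cong (*-congˡ (det-ᵀ (suc s) (minor M zero zero)))
                (trans (∑-comm (λ j i → term M i j)) (∑-cong λ i → ∑-cong λ j → swap-term i j)) ⟩
    1# * M zero zero * Det (minor M zero zero ᵀ) + ∑ (λ i → ∑ λ j → term (M ᵀ) j i)
      ≈⟨ det-expand (det-ᵀ (suc s)) (M ᵀ) ⟨
    Det (M ᵀ) ∎
    where
    corner : Carrier
    corner = 1# * M zero zero * Det (minor M zero zero)

    term : Matrix (suc (suc s)) → Fin (suc s) → Fin (suc s) → Carrier
    term N i j = sgn (suc j) * N zero (suc j) * (sgn i * N (suc i) zero * Det (minor (minor N zero zero) i j ᵀ))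

    swap-term : ∀ i j → term M i j ≈ term (M ᵀ) j i
    swap-term i j = trans
      (*-congˡ (*-congˡ (sym (det-ᵀ s (minor (minor M zero zero) i j)))))
      (solve 6 (λ a b c d e f → (a :* b) :* c :* (d :* e :* f) := (a :* d) :* e :* (b :* c :* f)) refl
         (- 1#) (sgn j) (M zero (suc j)) (sgn i) (M (suc i) zero) _)

  det-column : ∀ {s} (M : Matrix (suc s)) → Det M ≈ ∑ λ i → sgn i * M i zero * Det (minor M i zero)
  det-column {s} M = trans (trans (det-ᵀ (suc s) M) (det-row _)) (∑-cong λ i → *-congˡ (sym (det-ᵀ s (minor M i zero))))

  swap₀₁ : ∀ {s} → Fin (suc (suc s)) → Fin (suc (suc s))
  swap₀₁ zero          = suc zero
  swap₀₁ (suc zero)    = zero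
  swap₀₁ (suc (suc i)) = suc (suc i)

  -- In the expansion along the first column, the terms of rows 0 and 1 trade places with opposite
  -- signs. Every other minor still contains both rows, so its sign changes by induction.
  det-swap₀₁ : ∀ s (M : Matrix (suc (suc s))) → Det (λ i j → M (swap₀₁ i) j) ≈ - Det M
  det-swap₀₁-term : ∀ s (M : Matrix (suc (suc s))) (i : Fin s) →
    let M′ = λ i j → M (swap₀₁ i) j in
    sgn (suc (suc i)) * M′ (suc (suc i)) zero * Det (minor M′ (suc (suc i)) zero) ≈
    - (sgn (suc (suc i)) * M (suc (suc i)) zero * Det (minor M (suc (suc i)) zero))

  det-swap₀₁-term (suc s) M i = begin
    sgn i″ * M i″ zero * Det (minor M′ i″ zero)
      ≈⟨ *-congˡ (trans (det-cong swap-minor) (det-swap₀₁ s (minor M i″ zero))) ⟩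
    sgn i″ * M i″ zero * - Det (minor M i″ zero)
      ≈⟨ -‿distribʳ-* _ _ ⟨
    - (sgn i″ * M i″ zero * Det (minor M i″ zero)) ∎
    where
    i″ : Fin (suc (suc (suc s)))
    i″ = suc (suc i)

    M′ : Matrix (suc (suc (suc s)))
    M′ i j = M (swap₀₁ i) j

    swap-minor : ∀ a b → minor M′ i″ zero a b ≈ minor M i″ zero (swap₀₁ a) b
    swap-minor zero          b = refl
    swap-minor (suc zero)    b = refl
    swap-minor (suc (suc a)) b = refl

  det-swap₀₁ s M = begin
    Det M′
      ≈⟨ split M′ ⟩
    term M′ zero + (term M′ (suc zero) + ∑ (λ i → term M′ (suc (suc i))))
      ≈⟨ +-cong (*-congˡ (det-cong minor₀)) (+-cong (*-congˡ (det-cong minor₁))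
           (trans (∑-cong (det-swap₀₁-term s M)) (∑-neg _))) ⟩
    1# * M (suc zero) zero * D₁ + (- 1# * 1# * M zero zero * D₀ - rest)
      -- The unit enters as a variable `o`, because the solver's coefficient 1 denotes `1# + 0#`.
      -- The relation o · o = o is therefore applied by hand in the next step.
      ≈⟨ solve 6 (λ o a b d e r → o :* a :* d :+ ((:- o) :* o :* b :* e :- r) :=
                                  o :* a :* d :+ (:- (o :* o) :* b :* e :- r)) refl 1# _ _ _ _ _ ⟩
    1# * M (suc zero) zero * D₁ + (- (1# * 1#) * M zero zero * D₀ - rest)
      ≈⟨ +-cong (*-congʳ (*-congʳ (sym (*-identityʳ 1#)))) (+-congʳ (*-congʳ (*-congʳ (-‿cong (*-identityʳ 1#))))) ⟩
    1# * 1# * M (suc zero) zero * D₁ + (- 1# * M zero zero * D₀ - rest)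
      ≈⟨ solve 6 (λ o a b d e r → o :* o :* a :* d :+ ((:- o) :* b :* e :- r) :=
                                  :- (o :* b :* e :+ ((:- o) :* o :* a :* d :+ r))) refl 1# _ _ _ _ _ ⟩
    - (term M zero + (term M (suc zero) + rest))
      ≈⟨ -‿cong (split M) ⟨
    - Det M ∎
    where
    M′ : Matrix (suc (suc s))
    M′ i j = M (swap₀₁ i) j

    term : Matrix (suc (suc s)) → Fin (suc (suc s)) → Carrier
    term N i = sgn i * N i zero * Det (minor N i zero)

    split : ∀ N → Det N ≈ term N zero + (term N (suc zero) + ∑ (λ i → term N (suc (suc i))))
    split N = trans (det-column N) (trans (∑-suc _) (+-congˡ (∑-suc _)))

    D₀ D₁ rest : Carrier
    D₀ = Det (minor M zero zero)
    D₁ = Det (minor M (suc zero) zero)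
    rest = ∑ (λ i → term M (suc (suc i)))

    minor₀ : ∀ a b → minor M′ zero zero a b ≈ minor M (suc zero) zero a b
    minor₀ zero    b = refl
    minor₀ (suc a) b = refl

    minor₁ : ∀ a b → minor M′ (suc zero) zero a b ≈ minor M zero zero a b
    minor₁ zero    b = refl
    minor₁ (suc a) b = refl

  -- σ plays the part of the sign of π. Recording the effect on determinants makes signs compose
  -- without a notion of parity.
  ScalesDet : ∀ {s} → (Fin s → Fin s) → Carrier → Set _
  ScalesDet {s} π σ = ∀ (M : Matrix s) → Det (λ i j → M (π i) j) ≈ σ * Det M

  scalesDet-lift : ∀ {s} {π : Fin s → Fin s} {σ} → ScalesDet π σ → ScalesDet (lift 1 π) σ
  scalesDet-lift {π = π} {σ} h M = begin
    Det (λ i j → M (lift 1 π i) j)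
      ≈⟨ trans (det-row _) (∑-cong λ j → *-congˡ (h (minor M zero j))) ⟩
    ∑ (λ j → sgn j * M zero j * (σ * Det (minor M zero j)))
      ≈⟨ ∑-cong (λ j → solve 3 (λ a σ d → a :* (σ :* d) := σ :* (a :* d)) refl _ σ _) ⟩
    ∑ (λ j → σ * (sgn j * M zero j * Det (minor M zero j)))
      ≈⟨ trans (*-congˡ (det-row M)) (*-distribˡ-∑ σ _) ⟨
    σ * Det M ∎

  scalesDet-∘ : ∀ {s} {π ρ : Fin s → Fin s} {σ τ} → ScalesDet π σ → ScalesDet ρ τ → ScalesDet (π ∘ ρ) (τ * σ)
  scalesDet-∘ {π = π} h k M = trans (k (λ i j → M (π i) j)) (trans (*-congˡ (h M)) (sym (*-assoc _ _ _)))

  front : ∀ {s} → Fin (suc s) → Fin (suc s) → Fin (suc s)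
  front w zero    = w
  front w (suc i) = punchIn w i

  -- The cycle `front (suc w)` is `lift 1 (front w)` after the exchange of positions 0 and 1, so
  -- each step of w contributes one factor -1.
  scalesDet-front : ∀ {s} (w : Fin (suc s)) → ScalesDet (front w) (sgn w)
  scalesDet-front zero M = trans (det-cong front₀) (sym (*-identityˡ _))
    where
    front₀ : ∀ i j → M (front zero i) j ≈ M i j
    front₀ zero    j = refl
    front₀ (suc i) j = refl
  scalesDet-front {suc s} (suc w) M = begin
    Det (λ i j → M (front (suc w) i) j)
      ≈⟨ det-cong front-suc ⟩
    Det (λ i j → M (lift 1 (front w) (swap₀₁ i)) j)
      ≈⟨ det-swap₀₁ s (λ i j → M (lift 1 (front w) i) j) ⟩
    - Det (λ i j → M (lift 1 (front w) i) j)
      ≈⟨ -‿cong (scalesDet-lift (scalesDet-front w) M) ⟩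
    - (sgn w * Det M)
      ≈⟨ -1*x≈-x _ ⟨
    - 1# * (sgn w * Det M)
      ≈⟨ *-assoc _ _ _ ⟨
    sgn (suc w) * Det M ∎
    where
    front-suc : ∀ i j → M (front (suc w) i) j ≈ M (lift 1 (front w) (swap₀₁ i)) j
    front-suc zero          j = refl
    front-suc (suc zero)    j = refl
    front-suc (suc (suc i)) j = refl

  sgn² : ∀ {s} (w : Fin s) → sgn w * sgn w ≈ 1#
  sgn² zero = *-identityʳ 1#
  sgn² (suc w) = begin
    - 1# * sgn w * (- 1# * sgn w)  ≈⟨ solve 2 (λ o s → (:- o) :* s :* ((:- o) :* s) := (o :* o) :* (s :* s)) refl 1# (sgn w) ⟩
    1# * 1# * (sgn w * sgn w)      ≈⟨ *-cong (*-identityʳ 1#) (sgn² w) ⟩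
    1# * 1#                        ≈⟨ *-identityʳ 1# ⟩
    1#                             ∎

  -- This is invariance under relabelling vertices: the rows contribute one factor σ, and the
  -- columns, through transposition, another.
  det-conjugate : ∀ {s} {π : Fin s → Fin s} {σ} → ScalesDet π σ → σ * σ ≈ 1# →
                  (M : Matrix s) → Det (λ i j → M (π i) (π j)) ≈ Det M
  det-conjugate {s} {π} {σ} h σ²≈1 M = begin
    Det (λ i j → M (π i) (π j))      ≈⟨ h (λ i j → M i (π j)) ⟩
    σ * Det (λ i j → M i (π j))      ≈⟨ *-congˡ (det-ᵀ s _) ⟩
    σ * Det (λ j i → M i (π j))      ≈⟨ *-congˡ (h (M ᵀ)) ⟩
    σ * (σ * Det (M ᵀ))              ≈⟨ *-assoc _ _ _ ⟨
    σ * σ * Det (M ᵀ)                ≈⟨ *-cong σ²≈1 (sym (det-ᵀ s M)) ⟩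
    1# * Det M                       ≈⟨ *-identityˡ _ ⟩
    Det M                            ∎

  det-equal₀₁ : ∀ {s} (M : Matrix (suc (suc s))) → (∀ j → M zero j ≈ M (suc zero) j) → Det M ≈ 0#
  det-equal₀₁ {s} M e = x≈-x⇒x≈0 (trans (det-cong swapped) (det-swap₀₁ s M))
    where
    swapped : ∀ i j → M i j ≈ M (swap₀₁ i) j
    swapped zero          j = e j
    swapped (suc zero)    j = sym (e j)
    swapped (suc (suc i)) j = refl

  -- A cycle of the rows below row 0 brings the equal row to position 1, where antisymmetry and the
  -- invertibility of 2 give zero. The sign of the cycle squares to 1.
  det-equal₀ : ∀ {s} (M : Matrix (suc s)) i → (∀ j → M zero j ≈ M (suc i) j) → Det M ≈ 0#
  det-equal₀ {suc s} M i e = begin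
    Det M                    ≈⟨ *-identityˡ _ ⟨
    1# * Det M               ≈⟨ *-congʳ (sgn² i) ⟨
    sgn i * sgn i * Det M    ≈⟨ *-assoc _ _ _ ⟩
    sgn i * (sgn i * Det M)  ≈⟨ *-congˡ (scalesDet-lift (scalesDet-front i) M) ⟨
    sgn i * Det (λ i′ j → M (lift 1 (front i) i′) j) ≈⟨ *-congˡ (det-equal₀₁ _ e) ⟩
    sgn i * 0#               ≈⟨ zeroʳ _ ⟩
    0#                       ∎

  setRow₀ : ∀ {s} → (Fin (suc s) → Carrier) → Matrix (suc s) → Matrix (suc s)
  setRow₀ r M zero    j = r j
  setRow₀ r M (suc i) j = M (suc i) j

  det-addRows : ∀ {s} (M : Matrix (suc s)) (y : Fin s → Carrier) →
                Det (setRow₀ (λ j → M zero j + ∑ λ i → y i * M (suc i) j) M) ≈ Det M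
  det-addRows {s} M y = begin
    Det (setRow₀ (λ j → M zero j + ∑ λ i → y i * M (suc i) j) M)
      ≈⟨ det-row _ ⟩
    ∑ (λ j → sgn j * (M zero j + ∑ λ i → y i * M (suc i) j) * D j)
      ≈⟨ ∑-cong (λ j → solve 4 (λ s m t d → s :* (m :+ t) :* d := s :* m :* d :+ (s :* d) :* t) refl (sgn j) (M zero j) _ (D j)) ⟩
    ∑ (λ j → sgn j * M zero j * D j + sgn j * D j * ∑ (λ i → y i * M (suc i) j))
      ≈⟨ trans (∑-+ _ _) (+-congʳ (sym (det-row M))) ⟩
    Det M + ∑ (λ j → sgn j * D j * ∑ (λ i → y i * M (suc i) j))
      ≈⟨ +-congˡ (∑-cong λ j → *-distribˡ-∑ (sgn j * D j) _) ⟩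
    Det M + ∑ (λ j → ∑ (λ i → sgn j * D j * (y i * M (suc i) j)))
      ≈⟨ +-congˡ (∑-comm (λ j i → sgn j * D j * (y i * M (suc i) j))) ⟩
    Det M + ∑ (λ i → ∑ (λ j → sgn j * D j * (y i * M (suc i) j)))
      ≈⟨ +-congˡ (∑-zero λ i → vanish i) ⟩
    Det M + 0#
      ≈⟨ +-identityʳ _ ⟩
    Det M ∎
    where
    D : Fin (suc s) → Carrier
    D j = Det (minor M zero j)

    vanish : ∀ i → ∑ (λ j → sgn j * D j * (y i * M (suc i) j)) ≈ 0#
    vanish i = begin
      ∑ (λ j → sgn j * D j * (y i * M (suc i) j))
        ≈⟨ ∑-cong (λ j → solve 4 (λ s d y m → s :* d :* (y :* m) := y :* (s :* m :* d)) refl (sgn j) (D j) (y i) _) ⟩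
      ∑ (λ j → y i * (sgn j * M (suc i) j * D j))
        -- The sum is the row expansion of `M` with row 0 overwritten by row `suc i`, a matrix with
        -- two equal rows.
        ≈⟨ trans (*-congˡ (det-row _)) (*-distribˡ-∑ (y i) _) ⟨
      y i * Det (setRow₀ (M (suc i)) M)
        ≈⟨ *-congˡ (det-equal₀ (setRow₀ (M (suc i)) M) i (λ j → refl)) ⟩
      y i * 0#
        ≈⟨ zeroʳ _ ⟩
      0# ∎

  -- Schur complements and block-diagonal determinants.

  punchIn-↑ˡ : ∀ {n} q (j : Fin (suc n)) (l : Fin n) → punchIn (j ↑ˡ q) (l ↑ˡ q) ≡ punchIn j l ↑ˡ q
  punchIn-↑ˡ q zero    l       = ≡.refl
  punchIn-↑ˡ q (suc j) zero    = ≡.refl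
  punchIn-↑ˡ q (suc j) (suc l) = ≡.cong suc (punchIn-↑ˡ q j l)

  punchIn-↑ʳ : ∀ {n q} (j : Fin (suc n)) (l : Fin q) → punchIn (j ↑ˡ q) (n ↑ʳ l) ≡ suc n ↑ʳ l
  punchIn-↑ʳ         zero    l = ≡.refl
  punchIn-↑ʳ {suc n} (suc j) l = ≡.cong suc (punchIn-↑ʳ j l)

  -- Y adds multiples of the last q rows to the first n, clearing the upper right block.
  det-schur : ∀ n {q} (M : Matrix (n ℕ.+ q)) (Y : Fin n → Fin q → Carrier) →
    (∀ i l → M (i ↑ˡ q) (n ↑ʳ l) + ∑ (λ j → Y i j * M (n ↑ʳ j) (n ↑ʳ l)) ≈ 0#) →
    Det M ≈ Det (λ i l → M (i ↑ˡ q) (l ↑ˡ q) + ∑ (λ j → Y i j * M (n ↑ʳ j) (l ↑ˡ q))) *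
            Det (λ j l → M (n ↑ʳ j) (n ↑ʳ l))
  det-schur zero M Y h = sym (trans (*-congʳ (det-zero _)) (*-identityˡ _))
  det-schur (suc n) {q} M Y h = begin
    Det M
      -- Only row 0 is cleared at this stage, with `y` extending `Y zero` by zeros on the other
      -- upper rows. Its expansion then runs over the first `suc n` columns, and each minor has the
      -- same block form with multipliers `Y ∘ suc`.
      ≈⟨ det-addRows M y ⟨
    Det (setRow₀ (λ j → M zero j + ∑ λ i → y i * M (suc i) j) M)
      ≈⟨ det-cong (λ { zero j → +-congˡ (trans (∑-↑ n _) (trans (+-cong (y-↑ˡ j) (y-↑ʳ j)) (+-identityˡ _))) ; (suc i) j → refl }) ⟩
    Det (setRow₀ r M)
      ≈⟨ trans (det-row _) (∑-↑ (suc n) _) ⟩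
    ∑ (λ j → sgn (j ↑ˡ q) * r (j ↑ˡ q) * Det (minor M zero (j ↑ˡ q))) +
    ∑ (λ l → sgn (suc n ↑ʳ l) * r (suc n ↑ʳ l) * Det (minor M zero (suc n ↑ʳ l)))
      ≈⟨ +-cong (∑-cong left) (∑-zero λ l → trans (*-congʳ (trans (*-congˡ (h zero l)) (zeroʳ _))) (zeroˡ _)) ⟩
    ∑ (λ j → sgn j * S zero j * Det (minor S zero j) * Det D) + 0#
      ≈⟨ +-identityʳ _ ⟩
    ∑ (λ j → sgn j * S zero j * Det (minor S zero j) * Det D)
      ≈⟨ trans (*-congʳ (det-row S)) (*-distribʳ-∑ (Det D) _) ⟨
    Det S * Det D ∎
    where
    S : Matrix (suc n)
    S i l = M (i ↑ˡ q) (l ↑ˡ q) + ∑ (λ j → Y i j * M (suc n ↑ʳ j) (l ↑ˡ q))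

    D : Matrix q
    D j l = M (suc n ↑ʳ j) (suc n ↑ʳ l)

    y : Fin (n ℕ.+ q) → Carrier
    y i = [ (λ _ → 0#) , Y zero ]′ (splitAt n i)

    r : Fin (suc n ℕ.+ q) → Carrier
    r j = M zero j + ∑ (λ l → Y zero l * M (suc n ↑ʳ l) j)

    y-↑ˡ : ∀ j → ∑ (λ i → y (i ↑ˡ q) * M (suc (i ↑ˡ q)) j) ≈ 0#
    y-↑ˡ j = ∑-zero λ i → trans (*-congʳ (reflexive (≡.cong [ (λ _ → 0#) , Y zero ]′ (splitAt-↑ˡ n i q)))) (zeroˡ _)

    y-↑ʳ : ∀ j → ∑ (λ l → y (n ↑ʳ l) * M (suc (n ↑ʳ l)) j) ≈ ∑ (λ l → Y zero l * M (suc n ↑ʳ l) j)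
    y-↑ʳ j = ∑-cong λ l → *-congʳ (reflexive (≡.cong [ (λ _ → 0#) , Y zero ]′ (splitAt-↑ʳ n q l)))

    module _ (j : Fin (suc n)) where
      N : Matrix (n ℕ.+ q)
      N = minor M zero (j ↑ˡ q)

      N-↑ˡ : ∀ a l → N a (l ↑ˡ q) ≈ M (suc a) (punchIn j l ↑ˡ q)
      N-↑ˡ a l = reflexive (≡.cong (M (suc a)) (punchIn-↑ˡ q j l))

      N-↑ʳ : ∀ a l → N a (n ↑ʳ l) ≈ M (suc a) (suc n ↑ʳ l)
      N-↑ʳ a l = reflexive (≡.cong (M (suc a)) (punchIn-↑ʳ j l))

      det-N : Det N ≈ Det (minor S zero j) * Det D
      det-N = trans
        (det-schur n N (Y ∘ suc)
          (λ i l → trans (+-cong (N-↑ʳ _ l) (∑-cong λ a → *-congˡ (N-↑ʳ _ l))) (h (suc i) l)))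
        (*-cong (det-cong λ i l → +-cong (N-↑ˡ _ l) (∑-cong λ a → *-congˡ (N-↑ˡ _ l)))
                (det-cong λ a l → N-↑ʳ _ l))

      left : sgn (j ↑ˡ q) * r (j ↑ˡ q) * Det N ≈ sgn j * S zero j * Det (minor S zero j) * Det D
      left = trans
        (*-cong (*-congʳ (reflexive (≡.cong ((- 1#) ^_) (toℕ-↑ˡ j q)))) det-N)
        (sym (*-assoc _ _ _))

  det-blockDiagonal : ∀ k {p} (D : Matrix p) →
    Det (λ a b → let i , w = remQuot {k} p a ; j , z = remQuot {k} p b in
                 if does (i ≟ j) then D w z else 0#) ≈ Det D ^ k
  det-blockDiagonal zero D = det-zero _
  det-blockDiagonal (suc k) {p} D = begin
    Det B
      -- The upper right block already vanishes, so the first copy of `D` splits off with zero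
      -- multipliers.
      ≈⟨ det-schur p B (λ _ _ → 0#) (λ w a → trans (+-cong (upper w a) (∑-zero λ _ → zeroˡ _)) (+-identityˡ _)) ⟩
    Det (λ w z → B (w ↑ˡ _) (z ↑ˡ _) + ∑ {k ℕ.* p} (λ a → 0# * B (p ↑ʳ a) (z ↑ˡ _))) * Det (λ a b → B (p ↑ʳ a) (p ↑ʳ b))
      ≈⟨ *-cong (det-cong λ w z → trans (+-cong (corner w z) (∑-zero λ _ → zeroˡ _)) (+-identityʳ _))
                (trans (det-cong lower) (det-blockDiagonal k D)) ⟩
    Det D * Det D ^ k ∎
    where
    E : ∀ {k} → Fin k × Fin p → Fin k × Fin p → Carrier
    E (i , w) (j , z) = if does (i ≟ j) then D w z else 0#

    B : Matrix (suc k ℕ.* p)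
    B a b = E (remQuot p a) (remQuot p b)

    upper : ∀ w a → B (w ↑ˡ _) (p ↑ʳ a) ≈ 0#
    upper w a = reflexive (≡.cong₂ E (remQuot-↑ˡ {k} w) (remQuot-↑ʳ {k} a))

    corner : ∀ w z → B (w ↑ˡ _) (z ↑ˡ _) ≈ D w z
    corner w z = reflexive (≡.cong₂ E (remQuot-↑ˡ {k} w) (remQuot-↑ˡ {k} z))

    lower : ∀ a b → B (p ↑ʳ a) (p ↑ʳ b) ≈ E {k} (remQuot p a) (remQuot p b)
    lower a b = reflexive (≡.cong₂ E (remQuot-↑ʳ {k} a) (remQuot-↑ʳ {k} b))

  module ↭ where
    open SetoidPermutation setoid public
    open SetoidPermutationProperties setoid public

  -- Polynomial functions

  Avoids : Carrier → List Carrier → Set _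
  Avoids x L = All (λ a → ¬ x ≈ a) L

  -- A point lying at least 1 above every member of the list differs from all of them.
  fresh : ∀ L → ∃[ x ] Avoids x L
  fresh L = let x , above = bound L in x , All.map (λ {a} a+1≤x x≈a → ¬x+1≤x a (Order.≤-respʳ-≈ x≈a a+1≤x)) above
    where
    bound : ∀ L → ∃[ x ] All (λ a → a + 1# ≤ x) L
    bound [] = 0# , []
    bound (a ∷ L) with bound L
    ... | x , above with Order.total (a + 1#) x
    ...   | inj₁ a+1≤x = x , a+1≤x ∷ above
    ...   | inj₂ x≤a+1 = a + 1# , Order.refl ∷ All.map (λ b+1≤x → Order.trans b+1≤x x≤a+1) above

  -- Coefficients start with the constant term. Lists are not normalised, so the length only bounds
  -- the degree; polynomials are compared through their values.
  eval : List Carrier → Carrier → Carrier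
  eval []       x = 0#
  eval (a ∷ as) x = a + x * eval as x

  _⊞_ : List Carrier → List Carrier → List Carrier
  []       ⊞ bs       = bs
  (a ∷ as) ⊞ []       = a ∷ as
  (a ∷ as) ⊞ (b ∷ bs) = (a + b) ∷ (as ⊞ bs)

  eval-⊞ : ∀ as bs x → eval (as ⊞ bs) x ≈ eval as x + eval bs x
  eval-⊞ []       bs       x = sym (+-identityˡ _)
  eval-⊞ (a ∷ as) []       x = sym (+-identityʳ _)
  eval-⊞ (a ∷ as) (b ∷ bs) x = trans (+-congˡ (*-congˡ (eval-⊞ as bs x)))
    (solve 5 (λ a b x e f → (a :+ b) :+ x :* (e :+ f) := (a :+ x :* e) :+ (b :+ x :* f)) refl a b x _ _)

  _⊡_ : Carrier → List Carrier → List Carrier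
  a ⊡ bs = map (a *_) bs

  eval-⊡ : ∀ a bs x → eval (a ⊡ bs) x ≈ a * eval bs x
  eval-⊡ a []       x = sym (zeroʳ a)
  eval-⊡ a (b ∷ bs) x = trans (+-congˡ (*-congˡ (eval-⊡ a bs x)))
    (solve 4 (λ a b x e → a :* b :+ x :* (a :* e) := a :* (b :+ x :* e)) refl a b x _)

  _⊠_ : List Carrier → List Carrier → List Carrier
  []       ⊠ bs = []
  (a ∷ as) ⊠ bs = (a ⊡ bs) ⊞ (0# ∷ (as ⊠ bs))

  eval-⊠ : ∀ as bs x → eval (as ⊠ bs) x ≈ eval as x * eval bs x
  eval-⊠ []       bs x = sym (zeroˡ _)
  eval-⊠ (a ∷ as) bs x = begin
    eval ((a ⊡ bs) ⊞ (0# ∷ (as ⊠ bs))) x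
      ≈⟨ eval-⊞ (a ⊡ bs) _ x ⟩
    eval (a ⊡ bs) x + (0# + x * eval (as ⊠ bs) x)
      ≈⟨ +-cong (eval-⊡ a bs x) (trans (+-identityˡ _) (*-congˡ (eval-⊠ as bs x))) ⟩
    a * eval bs x + x * (eval as x * eval bs x)
      ≈⟨ solve 4 (λ a b x e → a :* b :+ x :* (e :* b) := (a :+ x :* e) :* b) refl a _ x _ ⟩
    (a + x * eval as x) * eval bs x ∎

  -- The coefficients of (x g(x) − a g(a)) / (x − a), where g has coefficients bs.
  quotient : Carrier → List Carrier → List Carrier
  quotient a []       = []
  quotient a (b ∷ bs) = eval (b ∷ bs) a ∷ quotient a bs

  length-quotient : ∀ a bs → length (quotient a bs) ≡ length bs
  length-quotient a []       = ≡.refl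
  length-quotient a (b ∷ bs) = ≡.cong suc (length-quotient a bs)

  eval-quotient : ∀ a bs x → (x - a) * eval (quotient a bs) x ≈ x * eval bs x - a * eval bs a
  eval-quotient a [] x = solve 3 (λ x a z → (x :- a) :* con (ℤ.+ 0) := x :* con (ℤ.+ 0) :- a :* con (ℤ.+ 0)) refl x a 0#
  eval-quotient a (b ∷ bs) x = begin
    (x - a) * (g a + x * h)
      ≈⟨ solve 4 (λ x a g h → (x :- a) :* (g :+ x :* h) := (x :- a) :* g :+ x :* ((x :- a) :* h)) refl x a (g a) h ⟩
    (x - a) * g a + x * ((x - a) * h)
      ≈⟨ +-congˡ (*-congˡ (eval-quotient a bs x)) ⟩
    (x - a) * g a + x * (x * eval bs x - a * eval bs a)
      ≈⟨ solve 5 (λ x a b e f → (x :- a) :* (b :+ a :* f) :+ x :* (x :* e :- a :* f) :=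
                                x :* (b :+ x :* e) :- a :* (b :+ a :* f)) refl x a b (eval bs x) (eval bs a) ⟩
    x * g x - a * g a ∎
    where
    g : Carrier → Carrier
    g = eval (b ∷ bs)
    h : Carrier
    h = eval (quotient a bs) x

  -- A point r outside `L` is a root, so x - r divides off and the length drops. The quotient is
  -- known to vanish only where x - r is invertible, so r joins the excluded points in the recursive
  -- call.
  eval-vanishes : ∀ d as L → length as ≡ d → (∀ x → Avoids x L → eval as x ≈ 0#) → ∀ x → eval as x ≈ 0#
  eval-vanishes zero    []       L eq zeros x = refl
  eval-vanishes (suc d) (a ∷ as) L eq zeros x = begin
    eval (a ∷ as) x                          ≈⟨ factor x ⟩
    (x - r) * eval (quotient r as) x         ≈⟨ *-congˡ (eval-vanishes d (quotient r as) (r ∷ L) length≡d quotient-zeros x) ⟩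
    (x - r) * 0#                             ≈⟨ zeroʳ _ ⟩
    0#                                       ∎
    where
    r : Carrier
    r = proj₁ (fresh L)

    length≡d : length (quotient r as) ≡ d
    length≡d = ≡.trans (length-quotient r as) (ℕ.suc-injective eq)

    factor : ∀ x → eval (a ∷ as) x ≈ (x - r) * eval (quotient r as) x
    factor x = begin
      a + x * eval as x                                  ≈⟨ solve 3 (λ a e f → a :+ e := (a :+ f) :+ (e :- f)) refl a _ (r * eval as r) ⟩
      (a + r * eval as r) + (x * eval as x - r * eval as r) ≈⟨ +-cong (zeros r (proj₂ (fresh L))) (sym (eval-quotient r as x)) ⟩
      0# + (x - r) * eval (quotient r as) x              ≈⟨ +-identityˡ _ ⟩
      (x - r) * eval (quotient r as) x                   ∎

    quotient-zeros : ∀ x → Avoids x (r ∷ L) → eval (quotient r as) x ≈ 0#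
    quotient-zeros x (x≉r ∷ x∉L) = x*y≈0⇒y≈0 (λ x-r≈0 → x≉r (x-y≈0⇒x≈y x-r≈0)) (trans (sym (factor x)) (zeros x x∉L))

  Polynomial : (Carrier → Carrier) → Set _
  Polynomial f = ∃[ as ] (∀ x → f x ≈ eval as x)

  polynomial-const : ∀ a → Polynomial (λ _ → a)
  polynomial-const a = a ∷ [] , λ x → sym (trans (+-congˡ (zeroʳ x)) (+-identityʳ a))

  polynomial-id : Polynomial (λ x → x)
  polynomial-id = 0# ∷ 1# ∷ [] , λ x → sym (trans (+-identityˡ _) (trans (*-congˡ (trans (+-congˡ (zeroʳ x)) (+-identityʳ 1#))) (*-identityʳ x)))

  polynomial-+ : ∀ {f g} → Polynomial f → Polynomial g → Polynomial (λ x → f x + g x)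
  polynomial-+ (as , f≈) (bs , g≈) = as ⊞ bs , λ x → trans (+-cong (f≈ x) (g≈ x)) (sym (eval-⊞ as bs x))

  polynomial-* : ∀ {f g} → Polynomial f → Polynomial g → Polynomial (λ x → f x * g x)
  polynomial-* (as , f≈) (bs , g≈) = as ⊠ bs , λ x → trans (*-cong (f≈ x) (g≈ x)) (sym (eval-⊠ as bs x))

  polynomial-cong : ∀ {f g} → (∀ x → f x ≈ g x) → Polynomial g → Polynomial f
  polynomial-cong f≈g (as , g≈) = as , λ x → trans (f≈g x) (g≈ x)

  polynomial-neg : ∀ {f} → Polynomial f → Polynomial (λ x → - f x)
  polynomial-neg p = polynomial-cong (λ x → sym (-1*x≈-x _)) (polynomial-* (polynomial-const (- 1#)) p)

  polynomial-- : ∀ {f g} → Polynomial f → Polynomial g → Polynomial (λ x → f x - g x)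
  polynomial-- p q = polynomial-+ p (polynomial-neg q)

  polynomial-∑ : ∀ {s} {f : Fin s → Carrier → Carrier} → (∀ i → Polynomial (f i)) → Polynomial (λ x → ∑ λ i → f i x)
  polynomial-∑ {zero}  p = polynomial-cong (λ x → ∑-zero λ ()) (polynomial-const 0#)
  polynomial-∑ {suc s} p = polynomial-cong (λ x → ∑-suc _) (polynomial-+ (p zero) (polynomial-∑ (p ∘ suc)))

  polynomial-det : ∀ {s} {M : Carrier → Matrix s} → (∀ i j → Polynomial (λ x → M x i j)) → Polynomial (λ x → Det (M x))
  polynomial-det {zero}  p = polynomial-cong (λ x → det-zero _) (polynomial-const 1#)
  polynomial-det {suc s} p = polynomial-cong (λ x → det-row _) (polynomial-∑ λ j →
    polynomial-* (polynomial-* (polynomial-const (sgn j)) (p zero j)) (polynomial-det λ a b → p (suc a) (punchIn j b)))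

  polynomial-if : ∀ b {f g} → Polynomial f → Polynomial g → Polynomial (λ x → if b then f x else g x)
  polynomial-if true  p q = p
  polynomial-if false p q = q

  -- This removes the exceptions left by divisions: an identity obtained where the divisors are
  -- nonzero holds at their zeros as well.
  polynomial-unique : ∀ {f g} → Polynomial f → Polynomial g → ∀ L →
                      (∀ x → Avoids x L → f x ≈ g x) → ∀ x → f x ≈ g x
  polynomial-unique p q L e x with polynomial-- p q
  ... | as , f-g≈ = x-y≈0⇒x≈y (trans (f-g≈ x) (eval-vanishes (length as) as L ≡.refl
    (λ y y∉L → trans (sym (f-g≈ y)) (trans (+-congʳ (e y y∉L)) (-‿inverseʳ _))) x))

  -- Products of linear factors and their unique factorisation.

  rootProduct : List Carrier → Carrier → Carrier
  rootProduct L x = foldr (λ q y → (x - q) * y) 1# L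

  polynomial-rootProduct : ∀ L → Polynomial (rootProduct L)
  polynomial-rootProduct []      = polynomial-const 1#
  polynomial-rootProduct (q ∷ L) = polynomial-* (polynomial-- polynomial-id (polynomial-const q)) (polynomial-rootProduct L)

  rootProduct-++ : ∀ K L x → rootProduct (K ++ L) x ≈ rootProduct K x * rootProduct L x
  rootProduct-++ []      L x = sym (*-identityˡ _)
  rootProduct-++ (q ∷ K) L x = trans (*-congˡ (rootProduct-++ K L x)) (sym (*-assoc _ _ _))

  rootProduct-replicate : ∀ k q x → rootProduct (replicate k q) x ≈ (x - q) ^ k
  rootProduct-replicate zero    q x = refl
  rootProduct-replicate (suc k) q x = *-congˡ (rootProduct-replicate k q x)

  1^k≈1 : ∀ k → 1# ^ k ≈ 1#
  1^k≈1 zero    = refl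
  1^k≈1 (suc k) = trans (*-identityˡ _) (1^k≈1 k)

  rootProduct-concatMap-replicate : ∀ k qs x → rootProduct (concatMap (replicate k) qs) x ≈ rootProduct qs x ^ k
  rootProduct-concatMap-replicate k []       x = sym (1^k≈1 k)
  rootProduct-concatMap-replicate k (q ∷ qs) x = begin
    rootProduct (replicate k q ++ concatMap (replicate k) qs) x
      ≈⟨ rootProduct-++ (replicate k q) _ x ⟩
    rootProduct (replicate k q) x * rootProduct (concatMap (replicate k) qs) x
      ≈⟨ *-cong (rootProduct-replicate k q x) (rootProduct-concatMap-replicate k qs x) ⟩
    (x - q) ^ k * rootProduct qs x ^ k
      ≈⟨ ^-distrib-* _ _ k ⟨
    ((x - q) * rootProduct qs x) ^ k ∎

  rootProduct-≉0 : ∀ {x} L → Avoids x L → ¬ (rootProduct L x ≈ 0#)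
  rootProduct-≉0 []      _           e = 0≉1 (sym e)
  rootProduct-≉0 (q ∷ L) (x≉q ∷ x∉L) e = rootProduct-≉0 L x∉L (x*y≈0⇒y≈0 (λ x-q≈0 → x≉q (x-y≈0⇒x≈y x-q≈0)) e)

  rootProduct-↭ : ∀ {K L} x → K ↭ L → rootProduct K x ≈ rootProduct L x
  rootProduct-↭ x (↭.refl eq) = go eq
    where
    go : ∀ {K L} → Pointwise _≈_ K L → rootProduct K x ≈ rootProduct L x
    go []       = refl
    go (e ∷ es) = *-cong (+-congˡ (-‿cong e)) (go es)
  rootProduct-↭ x (↭.prep e p)    = *-cong (+-congˡ (-‿cong e)) (rootProduct-↭ x p)
  rootProduct-↭ x (↭.swap {ys = L} {x′ = a} {y′ = b} e e′ p) = trans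
    (*-cong (+-congˡ (-‿cong e)) (*-cong (+-congˡ (-‿cong e′)) (rootProduct-↭ x p)))
    (solve 3 (λ a b c → a :* (b :* c) := b :* (a :* c)) refl (x - a) (x - b) (rootProduct L x))
  rootProduct-↭ x (↭.trans p q)   = trans (rootProduct-↭ x p) (rootProduct-↭ x q)

  -- A field has no zero divisors and equality of scalars is decidable, so a search through `L` must
  -- meet q.
  extractRoot : ∀ L q → rootProduct L q ≈ 0# → ∃[ L′ ] L ↭ q ∷ L′
  extractRoot []      q e = ⊥-elim (0≉1 (sym e))
  extractRoot (a ∷ L) q e = go (q Order.≟ a)
    where
    go : Dec (q ≈ a) → ∃[ L′ ] a ∷ L ↭ q ∷ L′
    go (yes q≈a) = L , ↭.prep (sym q≈a) ↭.↭-refl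
    go (no q≉a) =
      let L′ , L↭q∷L′ = extractRoot L q (x*y≈0⇒y≈0 (λ q-a≈0 → q≉a (x-y≈0⇒x≈y q-a≈0)) e)
      in a ∷ L′ , ↭.↭-trans (↭.↭-prep a L↭q∷L′) (↭.↭-swap a q ↭.↭-refl)

  -- After a factor x - q is cancelled, the identity is known only for x different from q.
  -- `polynomial-unique` restores it at q, which is what allows a repeated root to be extracted
  -- again.
  extractRoots : ∀ qs L {f} → Polynomial f → (∀ x → rootProduct L x ≈ rootProduct qs x * f x) →
                 ∃[ T ] (L ↭ qs ++ T × (∀ x → rootProduct T x ≈ f x))
  extractRoots []       L     p e = L , ↭.↭-refl , λ x → trans (e x) (*-identityˡ _)
  extractRoots (q ∷ qs) L {f} p e =
    let T , L′↭qs++T , T≈f = extractRoots qs L′ p cancelled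
    in T , ↭.↭-trans L↭q∷L′ (↭.↭-prep q L′↭qs++T) , T≈f
    where
    q-root : rootProduct L q ≈ 0#
    q-root = begin
      rootProduct L q                     ≈⟨ e q ⟩
      (q - q) * rootProduct qs q * f q    ≈⟨ *-congʳ (*-congʳ (-‿inverseʳ q)) ⟩
      0# * rootProduct qs q * f q         ≈⟨ *-congʳ (zeroˡ _) ⟩
      0# * f q                            ≈⟨ zeroˡ _ ⟩
      0#                                  ∎

    L′ : List Carrier
    L′ = proj₁ (extractRoot L q q-root)

    L↭q∷L′ : L ↭ q ∷ L′
    L↭q∷L′ = proj₂ (extractRoot L q q-root)

    cancelled : ∀ x → rootProduct L′ x ≈ rootProduct qs x * f x
    cancelled = polynomial-unique (polynomial-rootProduct L′) (polynomial-* (polynomial-rootProduct qs) p) (q ∷ [])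
      λ { x (x≉q ∷ []) → *-cancelˡ (λ x-q≈0 → x≉q (x-y≈0⇒x≈y x-q≈0))
            (trans (sym (rootProduct-↭ x L↭q∷L′)) (trans (e x) (*-assoc _ _ _))) }

  rootProduct-injective : ∀ {K L} → (∀ x → rootProduct K x ≈ rootProduct L x) → K ↭ L
  rootProduct-injective {K} {L} e = go (extractRoots L K (polynomial-const 1#) (λ x → trans (e x) (sym (*-identityʳ _))))
    where
    go : ∃[ T ] (K ↭ L ++ T × (∀ x → rootProduct T x ≈ 1#)) → K ↭ L
    go ([]    , K↭L , _)   = ↭.↭-trans K↭L (↭.↭-reflexive (++-identityʳ L))
    -- A leftover root t would make the constant 1 vanish at t.
    go (t ∷ T , _   , T≈1) = ⊥-elim (0≉1 (trans (sym (trans (*-congʳ (-‿inverseʳ t)) (zeroˡ _))) (T≈1 t)))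

  length-concatMap-replicate : ∀ k (qs : List Carrier) → length (concatMap (replicate k) qs) ≡ k ℕ.* length qs
  length-concatMap-replicate k []       = ≡.sym (ℕ.*-zeroʳ k)
  length-concatMap-replicate k (q ∷ qs) = ≡.trans (length-++ (replicate k q))
    (≡.trans (≡.cong₂ ℕ._+_ (length-replicate k) (length-concatMap-replicate k qs)) (≡.sym (ℕ.*-suc k (length qs))))

  -- Degrees and diagonals

  ⟦_⟧ : Bool → Carrier
  ⟦ b ⟧ = if b then 1# else 0#

  ∣tabulate∣≈∑ : ∀ {s} (f : Fin s → Bool) → fromℕ ∣ Vec.tabulate f ∣ ≈ ∑ λ i → ⟦ f i ⟧
  ∣tabulate∣≈∑ {zero}  f = sym (∑-zero λ ())
  ∣tabulate∣≈∑ {suc s} f = trans (go (f zero)) (sym (∑-suc _))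
    where
    go : ∀ b → fromℕ ∣ b Vec.∷ Vec.tabulate (f ∘ suc) ∣ ≈ ⟦ b ⟧ + ∑ λ i → ⟦ f (suc i) ⟧
    go true  = +-congˡ (∣tabulate∣≈∑ (f ∘ suc))
    go false = trans (∣tabulate∣≈∑ (f ∘ suc)) (sym (+-identityˡ _))

  deg≈∑ : ∀ {s} (X : Graph (Fin s)) i → fromℕ (deg X i) ≈ ∑ λ j → ⟦ adj X i j ⟧
  deg≈∑ X i = ∣tabulate∣≈∑ (adj X i)

  ∣tabulate∣-punchIn : ∀ {s} (f : Fin (suc s) → Bool) w → f w ≡ false →
                       ∣ Vec.tabulate f ∣ ≡ ∣ Vec.tabulate (f ∘ punchIn w) ∣
  ∣tabulate∣-punchIn f zero e rewrite e = ≡.refl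
  ∣tabulate∣-punchIn {suc s} f (suc w) e = go (f zero)
    where
    go : ∀ b → ∣ b Vec.∷ Vec.tabulate (f ∘ suc) ∣ ≡ ∣ b Vec.∷ Vec.tabulate (f ∘ suc ∘ punchIn w) ∣
    go true  = ≡.cong suc (∣tabulate∣-punchIn (f ∘ suc) w e)
    go false = ∣tabulate∣-punchIn (f ∘ suc) w e

  ∣tabulate∣-full : ∀ {s} (f : Fin s → Bool) → ∣ Vec.tabulate f ∣ ≡ s → ∀ i → f i ≡ true
  ∣tabulate∣-full {s} f e i = ≡.trans (≡.sym (lookup∘tabulate f i))
    (≡.trans (≡.cong (λ p → Vec.lookup p i) (∣p∣≡n⇒p≡⊤ {p = Vec.tabulate f} e)) (lookup-replicate i true))

  -- Once the false entry of `w` itself is deleted, s entries remain and s of them are true.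
  dominating : ∀ {s} (X : Graph (Fin (suc s))) w → deg X w ≡ s → ∀ j → j ≢ w → adj X w j ≡ true
  dominating X w e j j≢w = ≡.trans (≡.cong (adj X w) (≡.sym (punchIn-punchOut (j≢w ∘ ≡.sym))))
    (∣tabulate∣-full (adj X w ∘ punchIn w) (≡.trans (≡.sym (∣tabulate∣-punchIn (adj X w) w (adj-irrefl X w))) e) _)

  ∑-select : ∀ {s} (i : Fin s) (f : Fin s → Carrier) a →
             ∑ (λ j → f j * (if does (j ≟ i) then a else 0#)) ≈ f i * a
  ∑-select {suc s} i f a = begin
    ∑ (λ j → f j * (if does (j ≟ i) then a else 0#))
      ≈⟨ ∑-remove i _ ⟩
    f i * (if does (i ≟ i) then a else 0#) + ∑ (λ j → f (punchIn i j) * (if does (punchIn i j ≟ i) then a else 0#))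
      ≈⟨ +-cong (*-congˡ (reflexive (≡.cong (if_then a else 0#) (dec-true (i ≟ i) ≡.refl))))
                (∑-zero λ j → trans (*-congˡ (reflexive (≡.cong (if_then a else 0#) (dec-false (punchIn i j ≟ i) (punchInᵢ≢i i j)))))
                                    (zeroʳ _)) ⟩
    f i * a + 0#
      ≈⟨ +-identityʳ _ ⟩
    f i * a ∎

  ∑-δ : ∀ {s} (i : Fin s) a → ∑ (λ j → if does (j ≟ i) then a else 0#) ≈ a
  ∑-δ i a = trans (∑-cong λ j → sym (*-identityˡ _)) (trans (∑-select i (λ _ → 1#) a) (*-identityˡ a))

  diagonal-injective : ∀ {s t} (f : Fin s → Fin t) → Injective _≡_ _≡_ f → ∀ d i j →
                       diagonal d (f i) (f j) ≡ diagonal (d ∘ f) i j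
  diagonal-injective f inj d i j = ≡.cong (if_then d (f i) else 0#) (does-⇔ (mk⇔ inj (≡.cong f)) (f i ≟ f j) (i ≟ j))

  diagonal-cong : ∀ {s} {d e : Fin s → Carrier} → (∀ i → d i ≈ e i) → ∀ i j → diagonal d i j ≈ diagonal e i j
  diagonal-cong d≈e i j = go (does (i ≟ j))
    where
    go : ∀ b → (if b then _ else 0#) ≈ (if b then _ else 0#)
    go true  = d≈e i
    go false = refl

  charMatrix : ∀ {s} → Graph (Fin s) → Carrier → Matrix s
  charMatrix X x i j = diagonal (λ _ → x) i j - Q X i j

  front-injective : ∀ {s} (w : Fin (suc s)) → Injective _≡_ _≡_ (front w)
  front-injective w {zero}  {zero}  e = ≡.refl
  front-injective w {zero}  {suc j} e = ⊥-elim (punchInᵢ≢i w j (≡.sym e))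
  front-injective w {suc i} {zero}  e = ⊥-elim (punchInᵢ≢i w i e)
  front-injective w {suc i} {suc j} e = ≡.cong suc (punchIn-injective w i j e)

  det₁ : (M : Matrix 1) → Det M ≈ M zero zero
  det₁ M = begin
    Det M                                                ≈⟨ trans (det-row M) (∑-suc _) ⟩
    1# * M zero zero * Det (minor M zero zero) + ∑ _     ≈⟨ +-cong (*-cong (*-identityˡ _) (det-zero _)) (∑-zero λ ()) ⟩
    M zero zero * 1# + 0#                                ≈⟨ trans (+-identityʳ _) (*-identityʳ _) ⟩
    M zero zero                                          ∎

  det₂ : (M : Matrix 2) → Det M ≈ M zero zero * M (suc zero) (suc zero) - M zero (suc zero) * M (suc zero) zero
  det₂ M = begin
    Det M
      ≈⟨ trans (det-row M) (trans (∑-suc _) (+-congˡ (∑-suc _))) ⟩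
    1# * M zero zero * Det (minor M zero zero) + (- 1# * 1# * M zero (suc zero) * Det (minor M zero (suc zero)) + ∑ _)
      ≈⟨ +-cong (*-cong (*-identityˡ _) (det₁ _)) (trans (+-congˡ (∑-zero λ ())) (trans (+-identityʳ _)
           (*-cong (trans (*-congʳ (*-identityʳ _)) (-1*x≈-x _)) (det₁ _)))) ⟩
    M zero zero * M (suc zero) (suc zero) + - M zero (suc zero) * M (suc zero) zero
      ≈⟨ +-congˡ (-‿distribˡ-* _ _) ⟨
    M zero zero * M (suc zero) (suc zero) - M zero (suc zero) * M (suc zero) zero ∎

  -- The pocket block and the characteristic polynomial of `H_uv`.

  -- The common column sum of the pocket block xI − (Q(H₂) + 2I).
  γ : ℕ → Carrier → Carrier
  γ r₂ x = x - fromℕ (2 ℕ.* r₂) - fromℕ 2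

  module PocketMatrix {p : ℕ} (Huv : EdgeGraph p) {r₂ : ℕ} (adm : Admissible Huv r₂) where
    open EdgeGraph Huv
    open Admissible adm

    ι≢u : ∀ w → ι w ≢ u
    ι≢u w = punchInᵢ≢i u (punchIn v′ w)

    u-v′ : punchIn u v′ ≡ v
    u-v′ = punchIn-punchOut (adj⇒≢ H edge)

    ι≢v : ∀ w → ι w ≢ v
    ι≢v w e = punchInᵢ≢i v′ w (punchIn-injective u _ _ (≡.trans e (≡.sym u-v′)))

    adj-u : ∀ w → adj H u (ι w) ≡ true
    adj-u w = dominating H u deg-u (ι w) (ι≢u w)

    adj-v : ∀ w → adj H v (ι w) ≡ true
    adj-v w = dominating H v deg-v (ι w) (ι≢v w)

    H₂-row : ∀ w → ∑ (λ z → ⟦ adj H₂ w z ⟧) ≈ fromℕ r₂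
    H₂-row w = trans (sym (deg≈∑ H₂ w)) (reflexive (≡.cong fromℕ (regular w)))

    -- A vertex of H₂ has r₂ neighbours in H₂ together with u and v, in `H_uv` as well as in G. One
    -- block therefore serves both graphs.
    pocket : Carrier → Matrix p
    pocket x w z = diagonal (λ _ → x) w z - (diagonal (λ _ → fromℕ (2 ℕ.+ r₂)) w z + ⟦ adj H₂ w z ⟧)

    pocket-column : ∀ x z → ∑ (λ w → pocket x w z) ≈ γ r₂ x
    pocket-column x z = begin
      ∑ (λ w → pocket x w z)
        ≈⟨ trans (∑-+ _ _) (+-congˡ (trans (∑-neg _) (-‿cong (∑-+ _ _)))) ⟩
      ∑ (λ w → diagonal (λ _ → x) w z) - (∑ (λ w → diagonal (λ _ → fromℕ (2 ℕ.+ r₂)) w z) + ∑ (λ w → ⟦ adj H₂ w z ⟧))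
        ≈⟨ +-cong (∑-δ z x) (-‿cong (+-cong (∑-δ z _)
             (trans (∑-cong λ w → reflexive (≡.cong ⟦_⟧ (adj-sym H₂ w z))) (H₂-row z)))) ⟩
      x - (fromℕ (2 ℕ.+ r₂) + fromℕ r₂)
        ≈⟨ +-congˡ (-‿cong (+-congʳ (×-homo-+ 1# 2 r₂))) ⟩
      x - (fromℕ 2 + fromℕ r₂ + fromℕ r₂)
        ≈⟨ solve 3 (λ x t r → x :- (t :+ r :+ r) := x :- (r :+ (r :+ con (ℤ.+ 0))) :- t) refl x (fromℕ 2) (fromℕ r₂) ⟩
      x - (fromℕ r₂ + (fromℕ r₂ + 0#)) - fromℕ 2
        ≈⟨ +-congʳ (+-congˡ (-‿cong (trans (×-homo-+ 1# r₂ (r₂ ℕ.+ 0)) (+-congˡ (×-homo-+ 1# r₂ 0))))) ⟨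
      γ r₂ x ∎

    -- ρ sends 0 and 1 to u and v, and 2 + w to ι w.
    ρ : Fin (2 ℕ.+ p) → Fin (2 ℕ.+ p)
    ρ = front u ∘ lift 1 (front v′)

    ρ-injective : Injective _≡_ _≡_ ρ
    ρ-injective e = lift-injective (front v′) (front-injective v′) 1 (front-injective u e)

    scalesDet-ρ : ScalesDet ρ (sgn v′ * sgn u)
    scalesDet-ρ = scalesDet-∘ (scalesDet-front u) (scalesDet-lift (scalesDet-front v′))

    H-matrix : Carrier → Matrix (2 ℕ.+ p)
    H-matrix x i j = diagonal (λ _ → x) i j - (diagonal (fromℕ ∘ deg H ∘ ρ) i j + ⟦ adj H (ρ i) (ρ j) ⟧)

    det-H-matrix : ∀ x → charPoly (Q H) x ≈ Det (H-matrix x)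
    det-H-matrix x = begin
      charPoly (Q H) x
        ≈⟨ Det≈det (charMatrix H x) ⟨
      Det (charMatrix H x)
        ≈⟨ det-conjugate scalesDet-ρ σ² (charMatrix H x) ⟨
      Det (λ i j → charMatrix H x (ρ i) (ρ j))
        ≈⟨ det-cong (λ i j → reflexive (≡.cong₂ (λ a b → a - (b + ⟦ adj H (ρ i) (ρ j) ⟧))
             (diagonal-injective ρ ρ-injective (λ _ → x) i j) (diagonal-injective ρ ρ-injective (fromℕ ∘ deg H) i j))) ⟩
      Det (H-matrix x) ∎
      where
      σ² : sgn v′ * sgn u * (sgn v′ * sgn u) ≈ 1#
      σ² = trans (solve 2 (λ a b → a :* b :* (a :* b) := (a :* a) :* (b :* b)) refl (sgn v′) (sgn u))
                 (trans (*-cong (sgn² v′) (sgn² u)) (*-identityʳ 1#))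

    deg-ι : ∀ w → fromℕ (deg H (ι w)) ≈ fromℕ (2 ℕ.+ r₂)
    deg-ι w = begin
      fromℕ (deg H (ι w))
        ≈⟨ deg≈∑ H (ι w) ⟩
      ∑ (λ j → ⟦ adj H (ι w) j ⟧)
        ≈⟨ trans (∑-remove u _) (+-congˡ (∑-remove v′ _)) ⟩
      ⟦ adj H (ι w) u ⟧ + (⟦ adj H (ι w) (punchIn u v′) ⟧ + ∑ (λ z → ⟦ adj H₂ w z ⟧))
        ≡⟨ ≡.cong₂ (λ a b → ⟦ a ⟧ + (⟦ b ⟧ + ∑ (λ z → ⟦ adj H₂ w z ⟧)))
             (≡.trans (adj-sym H _ _) (adj-u w))
             (≡.trans (≡.cong (adj H (ι w)) u-v′) (≡.trans (adj-sym H _ _) (adj-v w))) ⟩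
      1# + (1# + ∑ (λ z → ⟦ adj H₂ w z ⟧))
        ≈⟨ +-congˡ (+-congˡ (H₂-row w)) ⟩
      fromℕ (2 ℕ.+ r₂) ∎

    off-diagonal : ∀ {b} → b ≡ true → 0# - (0# + ⟦ b ⟧) ≈ - 1#
    off-diagonal ≡.refl = trans (+-identityˡ _) (-‿cong (+-identityˡ 1#))

    on-diagonal : ∀ x {d b} → d ≡ suc p → b ≡ false → x - (fromℕ d + ⟦ b ⟧) ≈ x - fromℕ (suc p)
    on-diagonal x ≡.refl ≡.refl = +-congˡ (-‿cong (+-identityʳ _))

    module _ (x y : Carrier) (γy≈1 : γ r₂ x * y ≈ 1#) where
      -- The Schur complement on u, v has a on the diagonal and b off it, with determinant (a - b)(a
      -- + b). Here a - b = x - p is the factor for the eigenvalue m - 2, and γ(a + b) = γ(x - m) -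
      -- 2p is the quadratic whose roots are ζ and η.
      a b : Carrier
      a = x - fromℕ (suc p) - fromℕ p * y
      b = - 1# - fromℕ p * y

      H-pocket : ∀ w z → H-matrix x (suc (suc w)) (suc (suc z)) ≈ pocket x w z
      H-pocket w z = +-congˡ (-‿cong (+-congʳ (diagonal-cong deg-ι w z)))

      adj-01 : ∀ w → (adj H u (ι w) ≡ true) × (adj H (punchIn u v′) (ι w) ≡ true)
      adj-01 w = adj-u w , ≡.trans (≡.cong (λ v → adj H v (ι w)) u-v′) (adj-v w)

      top-right : ∀ i w → H-matrix x (i ↑ˡ p) (2 ↑ʳ w) ≈ - 1#
      top-right zero       w = off-diagonal (proj₁ (adj-01 w))
      top-right (suc zero) w = off-diagonal (proj₂ (adj-01 w))

      bottom-left : ∀ w i → H-matrix x (2 ↑ʳ w) (i ↑ˡ p) ≈ - 1#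
      bottom-left w zero       = off-diagonal (≡.trans (adj-sym H _ _) (proj₁ (adj-01 w)))
      bottom-left w (suc zero) = off-diagonal (≡.trans (adj-sym H _ _) (proj₂ (adj-01 w)))

      eliminated : ∀ i w → H-matrix x (i ↑ˡ p) (2 ↑ʳ w) + ∑ (λ z → y * H-matrix x (2 ↑ʳ z) (2 ↑ʳ w)) ≈ 0#
      eliminated i w = begin
        H-matrix x (i ↑ˡ p) (2 ↑ʳ w) + ∑ (λ z → y * H-matrix x (2 ↑ʳ z) (2 ↑ʳ w))
          ≈⟨ +-cong (top-right i w) (∑-cong λ z → *-congˡ (H-pocket z w)) ⟩
        - 1# + ∑ (λ z → y * pocket x z w)
          ≈⟨ +-congˡ (*-distribˡ-∑ y _) ⟨
        - 1# + y * ∑ (λ z → pocket x z w)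
          -- With y = 1/γ, the pocket rows times y add up to the all-ones row, which cancels the
          -- border entry -1.
          ≈⟨ +-congˡ (trans (*-congˡ (pocket-column x w)) (trans (*-comm _ _) γy≈1)) ⟩
        - 1# + 1#
          ≈⟨ -‿inverseˡ 1# ⟩
        0# ∎

      correction : ∀ i → ∑ (λ z → y * H-matrix x (2 ↑ʳ z) (i ↑ˡ p)) ≈ - (fromℕ p * y)
      correction i = begin
        ∑ (λ z → y * H-matrix x (2 ↑ʳ z) (i ↑ˡ p))  ≈⟨ ∑-cong (λ z → trans (*-congˡ (bottom-left z i)) (*-comm _ _)) ⟩
        ∑ {p} (λ z → - 1# * y)                      ≈⟨ ∑-const p _ ⟩
        fromℕ p * (- 1# * y)                        ≈⟨ *-congˡ (-1*x≈-x y) ⟩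
        fromℕ p * - y                               ≈⟨ -‿distribʳ-* _ _ ⟨
        - (fromℕ p * y)                             ∎

      charPoly-H-Schur : charPoly (Q H) x ≈ (a * a - b * b) * Det (pocket x)
      charPoly-H-Schur = begin
        charPoly (Q H) x
          ≈⟨ det-H-matrix x ⟩
        Det (H-matrix x)
          ≈⟨ det-schur 2 (H-matrix x) (λ _ _ → y) eliminated ⟩
        Det (λ i j → H-matrix x (i ↑ˡ p) (j ↑ˡ p) + ∑ (λ z → y * H-matrix x (2 ↑ʳ z) (j ↑ˡ p))) *
        Det (λ w z → H-matrix x (2 ↑ʳ w) (2 ↑ʳ z))
          ≈⟨ *-cong (trans (det₂ _) (+-cong
               (*-cong (+-cong (on-diagonal x deg-u (adj-irrefl H _)) (correction zero))
                       (+-cong (on-diagonal x (≡.trans (≡.cong (deg H) u-v′) deg-v) (adj-irrefl H _)) (correction (suc zero))))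
               (-‿cong (*-cong (+-cong (off-diagonal (≡.trans (≡.cong (adj H u) u-v′) edge)) (correction (suc zero)))
                       (+-cong (off-diagonal (≡.trans (≡.cong (λ v → adj H v u) u-v′) (≡.trans (adj-sym H v u) edge))) (correction zero))))))
               (det-cong H-pocket) ⟩
        (a * a - b * b) * Det (pocket x) ∎

      charPoly-H : γ r₂ x * charPoly (Q H) x ≈
                   (x - fromℕ p) * (γ r₂ x * (x - fromℕ (2 ℕ.+ p)) - fromℕ (2 ℕ.* p)) * Det (pocket x)
      charPoly-H = begin
        γ r₂ x * charPoly (Q H) x
          ≈⟨ *-congˡ charPoly-H-Schur ⟩
        γ r₂ x * ((a * a - b * b) * Det (pocket x))
          ≈⟨ solve 6 (λ x y g o P D → let a = x :- (o :+ P) :- P :* y ; b = :- o :- P :* y in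
               g :* ((a :* a :- b :* b) :* D) :=
               (x :- P) :* (g :* (x :- (o :+ (o :+ P))) :- (P :+ P) :* (g :* y)) :* D)
               refl x y (γ r₂ x) 1# (fromℕ p) (Det (pocket x)) ⟩
        (x - fromℕ p) * (γ r₂ x * (x - fromℕ (2 ℕ.+ p)) - (fromℕ p + fromℕ p) * (γ r₂ x * y)) * Det (pocket x)
          ≈⟨ *-congʳ (*-congˡ (+-congˡ (-‿cong (trans (*-congˡ γy≈1) (trans (*-identityʳ _) 2p))))) ⟩
        (x - fromℕ p) * (γ r₂ x * (x - fromℕ (2 ℕ.+ p)) - fromℕ (2 ℕ.* p)) * Det (pocket x) ∎
        where
        2p : fromℕ p + fromℕ p ≈ fromℕ (2 ℕ.* p)
        2p = sym (trans (×-homo-+ 1# p (p ℕ.+ 0)) (+-congˡ (trans (×-homo-+ 1# p 0) (+-identityʳ _))))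

  -- Determinants of bordered block matrices.

  -- With D the pocket block and s = 1 this is the characteristic matrix of the graph
  -- with edge-pockets; with D the 1 × 1 block γ and s = p it has the same Schur
  -- complement, but no longer refers to the pockets.
  module Bordered {n k p : ℕ} (A : Matrix n) (R : Fin n → Fin k → Carrier) (s : Carrier) (D : Matrix p) where
    -- The weight s stands on one side of the border only. It then enters the Schur complement
    -- linearly, and no square root of p is called for.
    entry : Fin n ⊎ (Fin k × Fin p) → Fin n ⊎ (Fin k × Fin p) → Carrier
    entry (inj₁ a)       (inj₁ b)       = A a b
    entry (inj₁ a)       (inj₂ (i , w)) = - R a i
    entry (inj₂ (i , w)) (inj₁ b)       = - (s * R b i)
    entry (inj₂ (i , w)) (inj₂ (j , z)) = if does (i ≟ j) then D w z else 0#

    enumerate : Fin (n ℕ.+ k ℕ.* p) → Fin n ⊎ (Fin k × Fin p)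
    enumerate = Sum.map id (remQuot p) ∘ splitAt n

    bordered : Matrix (n ℕ.+ k ℕ.* p)
    bordered a b = entry (enumerate a) (enumerate b)

    enumerate-↑ˡ : ∀ a → enumerate (a ↑ˡ (k ℕ.* p)) ≡ inj₁ a
    enumerate-↑ˡ a = ≡.cong (Sum.map id (remQuot p)) (splitAt-↑ˡ n a (k ℕ.* p))

    enumerate-↑ʳ : ∀ l → enumerate (n ↑ʳ l) ≡ inj₂ (remQuot p l)
    enumerate-↑ʳ l = ≡.cong (Sum.map id (remQuot p)) (splitAt-↑ʳ n (k ℕ.* p) l)

    -- All p rows of block i receive the same multiplier `R a i * y`, so `D` enters the complement
    -- only through its column sum and its size. Each block contributes the product s · p, which is
    -- what the two uses of this lemma have in common.
    det-bordered : ∀ {g y} → (∀ z → ∑ (λ w → D w z) ≈ g) → g * y ≈ 1# →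
      Det bordered ≈ Det (λ a b → A a b - s * fromℕ p * (∑ λ i → R a i * y * R b i)) * Det D ^ k
    det-bordered {g} {y} column gy≈1 = begin
      Det bordered
        ≈⟨ det-schur n bordered Y eliminated ⟩
      Det (λ a b → bordered (a ↑ˡ _) (b ↑ˡ _) + ∑ (λ l → Y a l * bordered (n ↑ʳ l) (b ↑ˡ _))) *
      Det (λ l l′ → bordered (n ↑ʳ l) (n ↑ʳ l′))
        ≈⟨ *-cong (det-cong corner) (trans (det-cong λ l l′ → reflexive (≡.cong₂ entry (enumerate-↑ʳ l) (enumerate-↑ʳ l′)))
                                           (det-blockDiagonal k D)) ⟩
      Det (λ a b → A a b - s * fromℕ p * (∑ λ i → R a i * y * R b i)) * Det D ^ k ∎
      where
      Y : Fin n → Fin (k ℕ.* p) → Carrier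
      Y a l = R a (proj₁ (remQuot {k} p l)) * y

      ∑-Y : ∀ a v → ∑ (λ l → Y a l * entry (enumerate (n ↑ʳ l)) v) ≈ ∑ λ i → R a i * y * ∑ λ w → entry (inj₂ (i , w)) v
      ∑-Y a v = begin
        ∑ (λ l → Y a l * entry (enumerate (n ↑ʳ l)) v)
          ≈⟨ ∑-cong (λ l → *-congˡ (reflexive (≡.cong (λ e → entry e v) (enumerate-↑ʳ l)))) ⟩
        ∑ (λ l → Y a l * entry (inj₂ (remQuot p l)) v)
          ≈⟨ ∑-remQuot k p (λ { (i , w) → R a i * y * entry (inj₂ (i , w)) v }) ⟩
        ∑ (λ i → ∑ λ w → R a i * y * entry (inj₂ (i , w)) v)
          ≈⟨ ∑-cong (λ i → *-distribˡ-∑ (R a i * y) _) ⟨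
        ∑ (λ i → R a i * y * ∑ λ w → entry (inj₂ (i , w)) v) ∎

      block-column : ∀ i j z → ∑ (λ w → entry (inj₂ (i , w)) (inj₂ (j , z))) ≈ (if does (i ≟ j) then g else 0#)
      block-column i j z = go (does (i ≟ j))
        where
        go : ∀ b → ∑ (λ w → if b then D w z else 0#) ≈ (if b then g else 0#)
        go true  = column z
        go false = ∑-zero λ _ → refl

      eliminated : ∀ a l → bordered (a ↑ˡ _) (n ↑ʳ l) + ∑ (λ l′ → Y a l′ * bordered (n ↑ʳ l′) (n ↑ʳ l)) ≈ 0#
      eliminated a l = begin
        bordered (a ↑ˡ _) (n ↑ʳ l) + ∑ (λ l′ → Y a l′ * bordered (n ↑ʳ l′) (n ↑ʳ l))
          ≈⟨ +-cong (reflexive (≡.cong₂ entry (enumerate-↑ˡ a) (enumerate-↑ʳ l)))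
                    (trans (∑-Y a _) (∑-cong λ i → *-congˡ (∑-cong λ w → reflexive (≡.cong (entry (inj₂ (i , w))) (enumerate-↑ʳ l))))) ⟩
        - R a j + ∑ (λ i → R a i * y * ∑ λ w → entry (inj₂ (i , w)) (inj₂ (j , z)))
          ≈⟨ +-congˡ (trans (∑-cong λ i → *-congˡ (block-column i j z)) (∑-select j _ g)) ⟩
        - R a j + R a j * y * g
          ≈⟨ +-congˡ (trans (*-assoc _ _ _) (trans (*-congˡ (trans (*-comm y g) gy≈1)) (*-identityʳ _))) ⟩
        - R a j + R a j
          ≈⟨ -‿inverseˡ _ ⟩
        0# ∎
        where
        j : Fin k
        j = proj₁ (remQuot {k} p l)
        z : Fin p
        z = proj₂ (remQuot {k} p l)

      corner : ∀ a b → bordered (a ↑ˡ _) (b ↑ˡ _) + ∑ (λ l → Y a l * bordered (n ↑ʳ l) (b ↑ˡ _)) ≈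
                       A a b - s * fromℕ p * (∑ λ i → R a i * y * R b i)
      corner a b = begin
        bordered (a ↑ˡ _) (b ↑ˡ _) + ∑ (λ l → Y a l * bordered (n ↑ʳ l) (b ↑ˡ _))
          ≈⟨ +-cong (reflexive (≡.cong₂ entry (enumerate-↑ˡ a) (enumerate-↑ˡ b)))
                    (trans (∑-Y a _) (∑-cong λ i → *-congˡ (∑-cong λ w → reflexive (≡.cong (entry (inj₂ (i , w))) (enumerate-↑ˡ b))))) ⟩
        A a b + ∑ (λ i → R a i * y * ∑ {p} λ w → - (s * R b i))
          ≈⟨ +-congˡ (∑-cong λ i → trans (*-congˡ (∑-const p _))
               (solve 5 (λ r y P s r′ → r :* y :* (P :* (:- (s :* r′))) := :- (s :* P) :* (r :* y :* r′))
                  refl (R a i) y (fromℕ p) s (R b i))) ⟩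
        A a b + ∑ (λ i → - (s * fromℕ p) * (R a i * y * R b i))
          ≈⟨ +-congˡ (*-distribˡ-∑ (- (s * fromℕ p)) _) ⟨
        A a b + - (s * fromℕ p) * (∑ λ i → R a i * y * R b i)
          ≈⟨ +-congˡ (-‿distribˡ-* _ _) ⟨
        A a b - s * fromℕ p * (∑ λ i → R a i * y * R b i) ∎

  -- The characteristic matrix of G and its reduction to order n + k.

  ⟦⟧-attached : ∀ P Q {s t} → (P ≡ true → Q ≡ true → ⊥) → s ≡ true → t ≡ true →
                ⟦ (P ∧ s) ∨ (Q ∧ t) ⟧ ≈ ⟦ P ⟧ + ⟦ Q ⟧
  ⟦⟧-attached true  true  disjoint _ _ = ⊥-elim (disjoint ≡.refl ≡.refl)
  ⟦⟧-attached true  false _ ≡.refl _   = sym (+-identityʳ 1#)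
  ⟦⟧-attached false true  _ _ ≡.refl   = sym (+-identityˡ 1#)
  ⟦⟧-attached false false _ _ _        = sym (+-identityˡ 0#)

  module Incidence {n k : ℕ} (F : Graph (Fin n)) (E : EdgeSet F k) (p : ℕ) where
    open EdgeSet E

    -- This is the vertex-edge incidence matrix of (V(F), E_k). As u and v are joined to all of H₂,
    -- it also gives the adjacency of x to every vertex of pocket i.
    R : Fin n → Fin k → Carrier
    R x i = ⟦ does (x ≟ a i) ⟧ + ⟦ does (x ≟ b i) ⟧

    d : Fin n → Carrier
    d x = ∑ (λ y → ⟦ adj F x y ⟧) + ∑ λ i → fromℕ p * R x i

    top : Carrier → Matrix n
    top x i j = diagonal (λ _ → x) i j - (diagonal d i j + ⟦ adj F i j ⟧)

    a≢b : ∀ i → a i ≢ b i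
    a≢b i = adj⇒≢ F (isEdge i)

    ends-disjoint : ∀ x i → does (x ≟ a i) ≡ true → does (x ≟ b i) ≡ true → ⊥
    ends-disjoint x i P Q with x ≟ a i | x ≟ b i
    ... | yes x≡a | yes x≡b = a≢b i (≡.trans (≡.sym x≡a) x≡b)

    R-column : ∀ i → ∑ (λ x → R x i) ≈ fromℕ 2
    R-column i = trans (∑-+ _ _) (trans (+-cong (∑-δ (a i) 1#) (∑-δ (b i) 1#)) (+-congˡ (sym (+-identityʳ 1#))))

    module _ (Huv : EdgeGraph p) {r₂ : ℕ} (adm : Admissible Huv r₂) where
      open EdgeGraph Huv
      open PocketMatrix Huv adm
      open Pocket F E Huv

      ⟦attached⟧ : ∀ x i w → ⟦ attached x i w ⟧ ≈ R x i
      -- The ends of an edge are distinct, so the disjunction becomes a sum.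
      ⟦attached⟧ x i w = ⟦⟧-attached _ _ (ends-disjoint x i) (adj-u w) (adj-v w)

      -- Unlike equality of indices, this test reduces on the constructors of `Vertex`, so the
      -- matrix entries can be compared by cases on the two kinds of vertices.
      same : Vertex → Vertex → Bool
      same (inj₁ x)       (inj₁ y)       = does (x ≟ y)
      same (inj₁ _)       (inj₂ _)       = false
      same (inj₂ _)       (inj₁ _)       = false
      same (inj₂ (i , w)) (inj₂ (j , z)) = does (i ≟ j) ∧ does (w ≟ z)

      same-sound : ∀ v v′ → same v v′ ≡ true → v ≡ v′
      same-sound (inj₁ x) (inj₁ y) e with x ≟ y
      ... | yes ≡.refl = ≡.refl
      same-sound (inj₂ (i , w)) (inj₂ (j , z)) e with i ≟ j | w ≟ z
      ... | yes ≡.refl | yes ≡.refl = ≡.refl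

      same-refl : ∀ v → same v v ≡ true
      same-refl (inj₁ x) = dec-true (x ≟ x) ≡.refl
      same-refl (inj₂ (i , w)) = ≡.cong₂ _∧_ (dec-true (i ≟ i) ≡.refl) (dec-true (w ≟ w) ≡.refl)

      enumerate-injective : Injective _≡_ _≡_ enumerate
      enumerate-injective {s} {t} e = ≡.trans (≡.sym (left-inverse s)) (≡.trans (≡.cong back e) (left-inverse t))
        where
        back : Vertex → Fin (n ℕ.+ k ℕ.* p)
        back = join n (k ℕ.* p) ∘ Sum.map id (uncurry combine)

        map-back : ∀ q → Sum.map id (uncurry combine) (Sum.map id (remQuot {k} p) q) ≡ q
        map-back (inj₁ x) = ≡.refl
        map-back (inj₂ l) = ≡.cong inj₂ (combine-remQuot {k} p l)

        left-inverse : ∀ s → back (enumerate s) ≡ s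
        left-inverse s = ≡.trans (≡.cong (join n (k ℕ.* p)) (map-back (splitAt n s))) (join-splitAt n (k ℕ.* p) s)

      ≟-enumerate : ∀ s t → does (s ≟ t) ≡ same (enumerate s) (enumerate t)
      ≟-enumerate s t with s ≟ t
      ... | yes ≡.refl = ≡.sym (same-refl (enumerate s))
      ... | no s≢t = go (same (enumerate s) (enumerate t)) ≡.refl
        where
        go : ∀ q → same (enumerate s) (enumerate t) ≡ q → false ≡ q
        go true  e = ⊥-elim (s≢t (enumerate-injective (same-sound _ _ e)))
        go false e = ≡.refl

      ∑-enumerate : ∀ (f : Vertex → Carrier) →
                    ∑ (f ∘ enumerate) ≈ ∑ (λ x → f (inj₁ x)) + ∑ λ i → ∑ λ w → f (inj₂ (i , w))
      ∑-enumerate f = begin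
        ∑ (f ∘ enumerate)
          ≈⟨ ∑-↑ n _ ⟩
        ∑ (λ x → f (enumerate (x ↑ˡ _))) + ∑ (λ l → f (enumerate (n ↑ʳ l)))
          ≈⟨ +-cong (∑-cong λ x → reflexive (≡.cong (f ∘ Sum.map id (remQuot p)) (splitAt-↑ˡ n x _)))
                    (∑-cong λ l → reflexive (≡.cong (f ∘ Sum.map id (remQuot p)) (splitAt-↑ʳ n (k ℕ.* p) l))) ⟩
        ∑ (λ x → f (inj₁ x)) + ∑ (λ l → f (inj₂ (remQuot p l)))
          ≈⟨ +-congˡ (∑-remQuot k p (f ∘ inj₂)) ⟩
        ∑ (λ x → f (inj₁ x)) + (∑ λ i → ∑ λ w → f (inj₂ (i , w))) ∎

      degree : Vertex → Carrier
      degree (inj₁ x) = d x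
      degree (inj₂ _) = fromℕ (2 ℕ.+ r₂)

      degree-sum : ∀ v → ∑ (λ x → ⟦ adjG v (inj₁ x) ⟧) + (∑ λ i → ∑ λ w → ⟦ adjG v (inj₂ (i , w)) ⟧) ≈ degree v
      degree-sum (inj₁ x) = +-congˡ (∑-cong λ i → trans (∑-cong λ w → ⟦attached⟧ x i w) (∑-const p (R x i)))
      degree-sum (inj₂ (i , w)) = begin
        ∑ (λ x → ⟦ attached x i w ⟧) + (∑ λ j → ∑ λ z → ⟦ does (i ≟ j) ∧ adj H₂ w z ⟧)
          ≈⟨ +-cong (trans (∑-cong λ x → ⟦attached⟧ x i w) (R-column i))
                    (trans (∑-cong λ j → trans (copy (does (i ≟ j))) (reflexive (≡.cong (if_then _ else 0#) (does-⇔ (mk⇔ ≡.sym ≡.sym) (i ≟ j) (j ≟ i)))))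
                           (∑-δ i _)) ⟩
        fromℕ 2 + ∑ (λ z → ⟦ adj H₂ w z ⟧)
          ≈⟨ +-congˡ (H₂-row w) ⟩
        fromℕ 2 + fromℕ r₂
          ≈⟨ ×-homo-+ 1# 2 r₂ ⟨
        fromℕ (2 ℕ.+ r₂) ∎
        where
        copy : ∀ q → ∑ (λ z → ⟦ q ∧ adj H₂ w z ⟧) ≈ (if q then ∑ (λ z → ⟦ adj H₂ w z ⟧) else 0#)
        copy true  = refl
        copy false = ∑-zero λ _ → refl

      deg-G : ∀ s → fromℕ (deg G[ F , E , Huv ] s) ≈ degree (enumerate s)
      deg-G s = trans (deg≈∑ G[ F , E , Huv ] s)
        (trans (∑-enumerate (λ v → ⟦ adjG (enumerate s) v ⟧)) (degree-sum (enumerate s)))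

      module G-Bordered (x : Carrier) = Bordered (top x) R 1# (pocket x)

      vertexEntry : Carrier → Vertex → Vertex → Carrier
      vertexEntry x v v′ = (if same v v′ then x else 0#) - ((if same v v′ then degree v else 0#) + ⟦ adjG v v′ ⟧)

      vertexEntry≈entry : ∀ x v v′ → vertexEntry x v v′ ≈ G-Bordered.entry x v v′
      vertexEntry≈entry x (inj₁ y)       (inj₁ z)       = refl
      vertexEntry≈entry x (inj₁ y)       (inj₂ (i , w)) =
        trans (+-identityˡ _) (-‿cong (trans (+-identityˡ _) (⟦attached⟧ y i w)))
      vertexEntry≈entry x (inj₂ (i , w)) (inj₁ y)       =
        trans (+-identityˡ _) (-‿cong (trans (+-identityˡ _) (trans (⟦attached⟧ y i w) (sym (*-identityˡ _)))))
      vertexEntry≈entry x (inj₂ (i , w)) (inj₂ (j , z)) = go (does (i ≟ j))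
        where
        go : ∀ q → (if q ∧ does (w ≟ z) then x else 0#) - ((if q ∧ does (w ≟ z) then fromℕ (2 ℕ.+ r₂) else 0#) + ⟦ q ∧ adj H₂ w z ⟧)
                 ≈ (if q then pocket x w z else 0#)
        go true  = refl
        go false = trans (+-congˡ (-‿cong (+-identityˡ 0#))) (-‿inverseʳ 0#)

      charMatrix-G : ∀ x s t → charMatrix G[ F , E , Huv ] x s t ≈ G-Bordered.bordered x s t
      charMatrix-G x s t = begin
        diagonal (λ _ → x) s t - (diagonal (fromℕ ∘ deg G[ F , E , Huv ]) s t + ⟦ adjG (enumerate s) (enumerate t) ⟧)
          ≈⟨ +-congˡ (-‿cong (+-congʳ (diagonal-cong deg-G s t))) ⟩
        diagonal (λ _ → x) s t - (diagonal (degree ∘ enumerate) s t + ⟦ adjG (enumerate s) (enumerate t) ⟧)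
          ≡⟨ ≡.cong (λ q → (if q then x else 0#) - ((if q then degree (enumerate s) else 0#) + ⟦ adjG (enumerate s) (enumerate t) ⟧))
                    (≟-enumerate s t) ⟩
        vertexEntry x (enumerate s) (enumerate t)
          ≈⟨ vertexEntry≈entry x (enumerate s) (enumerate t) ⟩
        G-Bordered.bordered x s t ∎

      charPoly-G : ∀ x → charPoly (Q G[ F , E , Huv ]) x ≈ Det (G-Bordered.bordered x)
      charPoly-G x = trans (sym (Det≈det (charMatrix G[ F , E , Huv ] x))) (det-cong (charMatrix-G x))

    module Reduced (r₂ : ℕ) where
      module _ (x : Carrier) where
        open Bordered {p = 1} (top x) R (fromℕ p) (λ _ _ → γ r₂ x) public

      -- The matrix has order n + k and is built from F, E_k, p and r₂ alone. Its determinant will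
      -- be the root product of the remaining eigenvalues.
      reduced : Carrier → Carrier
      reduced x = Det (bordered x)

      polynomial-γ : Polynomial (γ r₂)
      polynomial-γ = polynomial-- (polynomial-- polynomial-id (polynomial-const _)) (polynomial-const _)

      polynomial-reduced : Polynomial reduced
      -- The enumeration is the same for every x, so the value `0#` is arbitrary and the case
      -- distinction is uniform in x.
      polynomial-reduced = polynomial-det λ s t → go (enumerate 0# s) (enumerate 0# t)
        where
        go : ∀ v v′ → Polynomial (λ x → entry x v v′)
        go (inj₁ y) (inj₁ z) = polynomial-- (polynomial-if (does (y ≟ z)) polynomial-id (polynomial-const 0#)) (polynomial-const _)
        go (inj₁ y) (inj₂ _) = polynomial-const _
        go (inj₂ _) (inj₁ y) = polynomial-const _
        go (inj₂ (i , _)) (inj₂ (j , _)) = polynomial-if (does (i ≟ j)) polynomial-γ (polynomial-const 0#)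

      -- `det-bordered` is used forwards for the pockets and backwards for the single vertices. The
      -- complements agree because 1 · p = p · 1, and the k spare factors γ are the determinants of
      -- the 1 × 1 blocks.
      charPoly-G-reduced : ∀ (Huv : EdgeGraph p) (adm : Admissible Huv r₂) x → ¬ (γ r₂ x ≈ 0#) → ∀ Π →
        Det (PocketMatrix.pocket Huv adm x) ≈ γ r₂ x * Π → charPoly (Q G[ F , E , Huv ]) x ≈ Π ^ k * reduced x
      charPoly-G-reduced Huv adm x γ≉0 Π det-pocket = begin
        charPoly (Q G[ F , E , Huv ]) x
          ≈⟨ trans (charPoly-G Huv adm x) (G-Bordered.det-bordered Huv adm x (PocketMatrix.pocket-column Huv adm x) γy≈1) ⟩
        Det (λ s t → top x s t - 1# * fromℕ p * C s t) * Det (PocketMatrix.pocket Huv adm x) ^ k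
          ≈⟨ *-cong (det-cong λ s t → +-congˡ (-‿cong (*-congʳ (weights))))
                    (trans (^-congˡ k det-pocket) (^-distrib-* (γ r₂ x) Π k)) ⟩
        Det S * (γ r₂ x ^ k * Π ^ k)
          ≈⟨ trans (sym (*-assoc _ _ _)) (*-comm _ _) ⟩
        Π ^ k * (Det S * γ r₂ x ^ k)
          ≈⟨ *-congˡ (*-congˡ (^-congˡ k (det₁ _))) ⟨
        Π ^ k * (Det S * Det {1} (λ _ _ → γ r₂ x) ^ k)
          ≈⟨ *-congˡ (det-bordered x (λ _ → trans (∑-const 1 _) (trans (*-congʳ (+-identityʳ 1#)) (*-identityˡ _))) γy≈1) ⟨
        Π ^ k * reduced x ∎
        where
        y : Carrier
        y = proj₁ (inverse (γ r₂ x) γ≉0)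
        γy≈1 : γ r₂ x * y ≈ 1#
        γy≈1 = proj₂ (inverse (γ r₂ x) γ≉0)
        C S : Matrix n
        C s t = ∑ λ i → R s i * y * R t i
        S s t = top x s t - fromℕ p * fromℕ 1 * C s t
        weights : 1# * fromℕ p ≈ fromℕ p * fromℕ 1
        weights = trans (*-comm _ _) (*-congˡ (sym (+-identityʳ 1#)))

  -- The quadratic for ζ and η, and the eigenvalue count.

  quadratic-factor : ∀ s t ζ η →
    (∀ x → (x * x - s * x + t ≈ 0# → x ≈ ζ ⊎ x ≈ η) × (x ≈ ζ ⊎ x ≈ η → x * x - s * x + t ≈ 0#)) →
    ∀ x → x * x - s * x + t ≈ (x - ζ) * (x - η)
  -- The hypothesis describes the set of roots without multiplicities. The reflection of x to s - x
  -- preserves the quadratic, so s - ζ is a root and must be ζ or η; either way the factorisation is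
  -- determined.
  quadratic-factor s t ζ η roots x = go (proj₁ (roots (s - ζ)) conjugate)
    where
    f : Carrier → Carrier
    f x = x * x - s * x + t

    ζ-root : f ζ ≈ 0#
    ζ-root = proj₂ (roots ζ) (inj₁ refl)

    conjugate : f (s - ζ) ≈ 0#
    conjugate = trans (solve 3 (λ s t z → (s :- z) :* (s :- z) :- s :* (s :- z) :+ t := z :* z :- s :* z :+ t) refl s t ζ) ζ-root

    factored : ∀ ξ → s - ζ ≈ ξ → f x ≈ (x - ζ) * (x - ξ)
    factored ξ s-ζ≈ξ = begin
      f x                              ≈⟨ solve 4 (λ x s t z → x :* x :- s :* x :+ t := (x :- z) :* (x :- (s :- z)) :+ (z :* z :- s :* z :+ t)) refl x s t ζ ⟩
      (x - ζ) * (x - (s - ζ)) + f ζ    ≈⟨ +-cong (*-congˡ (+-congˡ (-‿cong s-ζ≈ξ))) ζ-root ⟩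
      (x - ζ) * (x - ξ) + 0#           ≈⟨ +-identityʳ _ ⟩
      (x - ζ) * (x - ξ)                ∎

    go : s - ζ ≈ ζ ⊎ s - ζ ≈ η → f x ≈ (x - ζ) * (x - η)
    go (inj₂ e) = factored η e
    go (inj₁ e) = trans (factored ζ e) (*-congˡ (+-congˡ (-‿cong ζ≈η)))
      where
      -- s = 2ζ makes ζ a double root, so the root η satisfies (η − ζ)² = 0.
      ζ≈η : ζ ≈ η
      ζ≈η with ζ Order.≟ η
      ... | yes ζ≈η = ζ≈η
      ... | no ζ≉η = ⊥-elim (η-ζ≉0 (x*y≈0⇒y≈0 η-ζ≉0 (trans (sym double) (proj₂ (roots η) (inj₂ refl)))))
        where
        η-ζ≉0 : ¬ (η - ζ ≈ 0#)
        η-ζ≉0 e = ζ≉η (sym (x-y≈0⇒x≈y e))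
        double : f η ≈ (η - ζ) * (η - ζ)
        double = begin
          f η                              ≈⟨ solve 4 (λ x s t z → x :* x :- s :* x :+ t := (x :- z) :* (x :- (s :- z)) :+ (z :* z :- s :* z :+ t)) refl η s t ζ ⟩
          (η - ζ) * (η - (s - ζ)) + f ζ    ≈⟨ +-cong (*-congˡ (+-congˡ (-‿cong e))) ζ-root ⟩
          (η - ζ) * (η - ζ) + 0#           ≈⟨ +-identityʳ _ ⟩
          (η - ζ) * (η - ζ)                ∎

  -- Here l is the length of `qs`. Of the 2 + p eigenvalues of `H_uv` three are exceptional, so p =
  -- l + 1, and each pocket leaves one eigenvalue of G unaccounted for.
  remaining-count : ∀ n k l t → k ℕ.* l ℕ.+ t ≡ n ℕ.+ k ℕ.* suc l → t ≡ n ℕ.+ k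
  remaining-count n k l t e = ℕ.+-cancelˡ-≡ (k ℕ.* l) t (n ℕ.+ k) (≡.trans e (rearrange n k l))
    where
    open +-*-Solver using () renaming (solve to solve-ℕ; _:+_ to _⊕_; _:*_ to _⊗_; _:=_ to _⊜_; con to lit)
    rearrange : ∀ n k l → n ℕ.+ k ℕ.* suc l ≡ k ℕ.* l ℕ.+ (n ℕ.+ k)
    rearrange = solve-ℕ 3 (λ n k l → n ⊕ k ⊗ (lit 1 ⊕ l) ⊜ k ⊗ l ⊕ (n ⊕ k)) ≡.refl

  -- Multiplicity k and independence of the remaining eigenvalues.

  module Theorem (n k p r₂ : ℕ) (F : Graph (Fin n)) (E : EdgeSet F k)
                 (ζ η : Carrier) (areRoots : AreRoots (2 ℕ.+ p) r₂ ζ η) where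
    open Incidence F E p
    open Reduced r₂

    exceptional : List Carrier
    exceptional = fromℕ p ∷ ζ ∷ η ∷ []

    γ₀ : Carrier
    γ₀ = fromℕ (2 ℕ.* r₂) + fromℕ 2

    γ≉0 : ∀ {x} → ¬ x ≈ γ₀ → ¬ γ r₂ x ≈ 0#
    γ≉0 {x} x≉γ₀ e = x≉γ₀ (x-y≈0⇒x≈y (trans (solve 3 (λ x a b → x :- (a :+ b) := x :- a :- b) refl x _ _) e))

    equation : Carrier → Carrier
    equation x = γ r₂ x * (x - fromℕ (2 ℕ.+ p)) - fromℕ (2 ℕ.* p)

    equation-factor : ∀ x → equation x ≈ (x - ζ) * (x - η)
    equation-factor x = trans (expand x) (quadratic-factor (A + B + C) ((A + B) * C - D) ζ η
      (λ x → (λ e → proj₁ (areRoots x) (trans (expand x) e)) , (λ e → trans (sym (expand x)) (proj₂ (areRoots x) e))) x)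
      where
      A B C D : Carrier
      A = fromℕ (2 ℕ.* r₂)
      B = fromℕ 2
      C = fromℕ (2 ℕ.+ p)
      D = fromℕ (2 ℕ.* p)
      expand : ∀ x → equation x ≈ x * x - (A + B + C) * x + ((A + B) * C - D)
      expand x = solve 5 (λ x a b c d → (x :- a :- b) :* (x :- c) :- d :=
        x :* x :- (a :+ b :+ c) :* x :+ ((a :+ b) :* c :- d)) refl x A B C D

    det-pocket : ∀ (Huv : EdgeGraph p) (adm : Admissible Huv r₂) qs →
      IsSpectrum (Q (EdgeGraph.H Huv)) (exceptional ++ qs) →
      ∀ x → Avoids x (γ₀ ∷ exceptional) → Det (PocketMatrix.pocket Huv adm x) ≈ γ r₂ x * rootProduct qs x
    det-pocket Huv adm qs (_ , spectrum) x (x≉γ₀ ∷ x∉) =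
      *-cancelˡ (rootProduct-≉0 exceptional x∉) (begin
        e * Det pocket
          ≈⟨ *-congʳ (trans (*-congˡ (*-congˡ (*-identityʳ _))) (*-congˡ (sym (equation-factor x)))) ⟩
        (x - fromℕ p) * equation x * Det pocket
          ≈⟨ PocketMatrix.charPoly-H Huv adm x (proj₁ γ⁻¹) (proj₂ γ⁻¹) ⟨
        γ r₂ x * charPoly (Q (EdgeGraph.H Huv)) x
          ≈⟨ *-congˡ (trans (spectrum x) (rootProduct-++ exceptional qs x)) ⟩
        γ r₂ x * (e * rootProduct qs x)
          ≈⟨ solve 3 (λ a b c → a :* (b :* c) := b :* (a :* c)) refl (γ r₂ x) e (rootProduct qs x) ⟩
        e * (γ r₂ x * rootProduct qs x) ∎)
      where
      pocket : Matrix p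
      pocket = PocketMatrix.pocket Huv adm x
      e : Carrier
      e = rootProduct exceptional x
      γ⁻¹ : ∃[ y ] γ r₂ x * y ≈ 1#
      γ⁻¹ = inverse (γ r₂ x) (γ≉0 x≉γ₀)

    -- The assumed list `S` makes the left side visibly polynomial, so the identity also reaches the
    -- zero of γ and the exceptional values, any of which may occur in `qs`.
    charPoly-G-factor : ∀ (Huv : EdgeGraph p) (adm : Admissible Huv r₂) qs →
      IsSpectrum (Q (EdgeGraph.H Huv)) (exceptional ++ qs) →
      ∀ S → IsSpectrum (Q G[ F , E , Huv ]) S →
      ∀ x → rootProduct S x ≈ rootProduct (concatMap (replicate k) qs) x * reduced x
    charPoly-G-factor Huv adm qs H-spectrum S (_ , G-spectrum) =
      polynomial-unique (polynomial-rootProduct S) (polynomial-* (polynomial-rootProduct (concatMap (replicate k) qs)) polynomial-reduced)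
        (γ₀ ∷ exceptional) λ { x x∉@(x≉γ₀ ∷ _) → begin
          rootProduct S x
            ≈⟨ G-spectrum x ⟨
          charPoly (Q G[ F , E , Huv ]) x
            ≈⟨ charPoly-G-reduced Huv adm x (γ≉0 x≉γ₀) (rootProduct qs x) (det-pocket Huv adm qs H-spectrum x x∉) ⟩
          rootProduct qs x ^ k * reduced x
            ≈⟨ *-congʳ (rootProduct-concatMap-replicate k qs x) ⟨
          rootProduct (concatMap (replicate k) qs) x * reduced x ∎ }

    multiplicity : ∀ (Huv : EdgeGraph p) → Admissible Huv r₂ →
      ∀ qs → IsSpectrum (Q (EdgeGraph.H Huv)) (exceptional ++ qs) →
      ∀ S → IsSpectrum (Q G[ F , E , Huv ]) S →
      ∃[ T ] (S ↭ concatMap (replicate k) qs ++ T × length T ≡ n ℕ.+ k)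
    multiplicity Huv adm qs H-spectrum S G-spectrum =
      let T , S↭qs++T , _ = extractRoots (concatMap (replicate k) qs) S polynomial-reduced
                              (charPoly-G-factor Huv adm qs H-spectrum S G-spectrum)
      in T , S↭qs++T , length-T T S↭qs++T
      where
      p≡ : p ≡ suc (length qs)
      p≡ = ≡.sym (ℕ.suc-injective (ℕ.suc-injective (proj₁ H-spectrum)))

      length-T : ∀ T → S ↭ concatMap (replicate k) qs ++ T → length T ≡ n ℕ.+ k
      length-T T S↭ = remaining-count n k (length qs) (length T) (≡.trans
        (≡.sym (≡.trans (length-++ (concatMap (replicate k) qs)) (≡.cong (ℕ._+ length T) (length-concatMap-replicate k qs))))
        (≡.trans (≡.sym (↭.xs↭ys⇒|xs|≡|ys| S↭)) (≡.trans (proj₁ G-spectrum) (≡.cong (λ p → n ℕ.+ k ℕ.* p) p≡))))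

    independence : ∀ (Huv Huv′ : EdgeGraph p) → Admissible Huv r₂ → Admissible Huv′ r₂ →
      ∀ qs qs′ →
      IsSpectrum (Q (EdgeGraph.H Huv)) (exceptional ++ qs) →
      IsSpectrum (Q (EdgeGraph.H Huv′)) (exceptional ++ qs′) →
      ∀ T T′ →
      IsSpectrum (Q G[ F , E , Huv ]) (concatMap (replicate k) qs ++ T) →
      IsSpectrum (Q G[ F , E , Huv′ ]) (concatMap (replicate k) qs′ ++ T′) →
      T ↭ T′
    independence Huv Huv′ adm adm′ qs qs′ H-spectrum H′-spectrum T T′ G-spectrum G′-spectrum =
      -- Both leftovers have root product `reduced`, which is shared by all admissible graphs with
      -- the same p and r₂.
      rootProduct-injective λ x → trans (remaining Huv adm qs H-spectrum T G-spectrum x)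
                                        (sym (remaining Huv′ adm′ qs′ H′-spectrum T′ G′-spectrum x))
      where
      remaining : ∀ (Huv : EdgeGraph p) → Admissible Huv r₂ → ∀ qs →
        IsSpectrum (Q (EdgeGraph.H Huv)) (exceptional ++ qs) →
        ∀ T → IsSpectrum (Q G[ F , E , Huv ]) (concatMap (replicate k) qs ++ T) →
        ∀ x → rootProduct T x ≈ reduced x
      remaining Huv adm qs H-spectrum T G-spectrum =
        polynomial-unique (polynomial-rootProduct T) polynomial-reduced K λ x x∉K →
          *-cancelˡ (rootProduct-≉0 K x∉K)
            (trans (sym (rootProduct-++ K T x)) (charPoly-G-factor Huv adm qs H-spectrum (K ++ T) G-spectrum x))
        where
        K : List Carrier
        K = concatMap (replicate k) qs

theorem4p2 :
  ∀ {c ℓ₁ ℓ₂} (ℝ : RealClosedField c ℓ₁ ℓ₂) →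
  let open RealClosedField ℝ using (Carrier)
      open Spectra ℝ
  in
  ∀ (n k p r r₂ : ℕ) (F : Graph (Fin n)) (E : EdgeSet F k) →
  let m = 2 ℕ.+ p in
  2 ℕ.≤ n → 3 ℕ.≤ m → 2 ℕ.≤ r₂ →
  EdgeSet.InducedRegular E r →
  ∀ (ζ η : Carrier) → AreRoots m r₂ ζ η →
  let exceptional = fromℕ (m ℕ.∸ 2) ∷ ζ ∷ η ∷ [] in
  -- qs is σ(Q(H_uv)) ∖ {m − 2, ζ, η}, as a multiset
  (∀ (Huv : EdgeGraph p) → Admissible Huv r₂ →
   ∀ (qs : List Carrier) → IsSpectrum (Q (EdgeGraph.H Huv)) (exceptional ++ qs) →
   ∀ (S : List Carrier) → IsSpectrum (Q G[ F , E , Huv ]) S →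
   ∃[ T ] (S ↭ concatMap (replicate k) qs ++ T × length T ≡ n ℕ.+ k))
  ×
  -- the remaining eigenvalues T do not depend on H_uv
  (∀ (Huv Huv′ : EdgeGraph p) → Admissible Huv r₂ → Admissible Huv′ r₂ →
   ∀ (qs qs′ : List Carrier) →
   IsSpectrum (Q (EdgeGraph.H Huv)) (exceptional ++ qs) →
   IsSpectrum (Q (EdgeGraph.H Huv′)) (exceptional ++ qs′) →
   ∀ (T T′ : List Carrier) →
   IsSpectrum (Q G[ F , E , Huv ]) (concatMap (replicate k) qs ++ T) →
   IsSpectrum (Q G[ F , E , Huv′ ]) (concatMap (replicate k) qs′ ++ T′) →
   T ↭ T′)
theorem4p2 ℝ n k p r r₂ F E _ _ _ _ ζ η areRoots = multiplicity , independence
  where open EdgePockets.Theorem ℝ n k p r₂ F E ζ η areRoots
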